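{- Let $A = x^a(x+1)^b(x+\alpha)^c(x+\alpha+1)^d \in \mathbb{F}_4[x]$ with $a,b,c,d\in\mathbb{N}$, and suppose that $A$ is bi-unitary perfect. Let $\mathcal{T}=\{r\in\mathbb{N}^* : r=2 \text{ or } r=2^n-1 \text{ for some } n\in\mathbb{N}^*\}$ and $\Sigma=\{(x^2+x)^r,\ (x^2+x+1)^r : r\in\mathcal{T}\}$. Then: i) if $\omega(A)=2$, then $A\in\Sigma$; ii) if $A$ is trivially bi-unitary perfect and $\omega(A)\ge 3$, then $A=A_1A_2$ for some $A_1,A_2\in\Sigma$.
   Context: $\mathbb{N}$ is the set of non-negative integers, $\mathbb{N}^*$ the set of positive integers. $\mathbb{F}_4=\{0,1,\alpha,\alpha+1\}$ is the field with 4 elements, with $\alpha^2+\alpha+1=0$. All divisors of polynomials are taken monic. For a monic polynomial $S$ over a finite field, a divisor $D$ of $S$ is unitary if $\gcd(D,S/D)=1$; $\gcd_u(S,T)$ denotes the greatest common unitary divisor of $S$ and $T$; a divisor $D$ of $S$ is bi-unitary if $\gcd_u(D,S/D)=1$. $\sigma^{**}(S)$ is the sum of all bi-unitary divisors of $S$, and $S$ is bi-unitary perfect if $\sigma^{**}(S)=S$. $\omega(S)$ is the number of distinct (monic) irreducible factors of $S$. A polynomial $A$ is trivially bi-unitary perfect if it is bi-unitary perfect and can be written $A=A_0\cdots A_r$ with $r\ge 1$, each $A_i$ nonconstant and bi-unitary perfect (over the same field), and $\gcd(A_i,A_j)=1$ for $i\ne j$. -}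

module Defs where

open import Level using (0ℓ)
open import Algebra.Bundles using (RawSemiring)
open import Data.Fin.Base using (Fin)
open import Data.List.Base using (List; []; _∷_; map; foldr; length)
open import Data.Nat.Base as ℕ using (ℕ; zero; suc; _<_; _≥_)
open import Data.Product.Base using (∃; _×_)
open import Data.Sum.Base using (_⊎_)
open import Data.Vec.Functional using (Vector)
open import Function.Bundles using (_⇔_)
open import Relation.Binary.Bundles using (Setoid)
open import Relation.Binary.PropositionalEquality using (_≡_; _≢_; _≗_; refl; sym; trans)
open import Relation.Unary using (Pred)

------------------------------------------------------------------------
-- The field 𝔽₄ = {0, 1, α, α + 1}, with α² + α + 1 = 0

data 𝔽₄ : Set where
  𝟎 𝟏 α α+1 : 𝔽₄

infixl 6 _+₄_
infixl 7 _*₄_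

_+₄_ : 𝔽₄ → 𝔽₄ → 𝔽₄
𝟎   +₄ y   = y
𝟏   +₄ 𝟎   = 𝟏
𝟏   +₄ 𝟏   = 𝟎
𝟏   +₄ α   = α+1
𝟏   +₄ α+1 = α
α   +₄ 𝟎   = α
α   +₄ 𝟏   = α+1
α   +₄ α   = 𝟎
α   +₄ α+1 = 𝟏
α+1 +₄ 𝟎   = α+1
α+1 +₄ 𝟏   = α
α+1 +₄ α   = 𝟏
α+1 +₄ α+1 = 𝟎

_*₄_ : 𝔽₄ → 𝔽₄ → 𝔽₄
𝟎   *₄ y   = 𝟎
𝟏   *₄ y   = y
α   *₄ 𝟎   = 𝟎
α   *₄ 𝟏   = α
α   *₄ α   = α+1
α   *₄ α+1 = 𝟏
α+1 *₄ 𝟎   = 𝟎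
α+1 *₄ 𝟏   = α+1
α+1 *₄ α   = 𝟏
α+1 *₄ α+1 = α

------------------------------------------------------------------------
-- 𝔽₄[x]

-- Coefficient lists, constant term first.  Trailing zeros are allowed, so
-- the equality of polynomials is _≈_ below, not _≡_.
Poly : Set
Poly = List 𝔽₄

coeff : Poly → ℕ → 𝔽₄
coeff []      _       = 𝟎
coeff (c ∷ p) zero    = c
coeff (c ∷ p) (suc i) = coeff p i

infix 4 _≈_

-- A record, rather than a synonym for the equality of coefficients, so that
-- p and q can be inferred from p ≈ q.
record _≈_ (p q : Poly) : Set where
  constructor mk≈
  field
    coeff≗ : coeff p ≗ coeff q

open _≈_ public

≈-setoid : Setoid 0ℓ 0ℓ
≈-setoid = record
  { Carrier       = Poly
  ; _≈_           = _≈_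
  ; isEquivalence = record
    { refl  = mk≈ λ _ → refl
    ; sym   = λ e → mk≈ λ i → sym (coeff≗ e i)
    ; trans = λ e f → mk≈ λ i → trans (coeff≗ e i) (coeff≗ f i)
    }
  }

infixl 6 _+_
infixl 7 _*_

_+_ : Poly → Poly → Poly
[]      + q       = q
(a ∷ p) + []      = a ∷ p
(a ∷ p) + (b ∷ q) = (a +₄ b) ∷ (p + q)

_*_ : Poly → Poly → Poly
[]      * q = []
(a ∷ p) * q = map (a *₄_) q + (𝟎 ∷ (p * q))

C : 𝔽₄ → Poly
C c = c ∷ []

X 0# 1# : Poly
X  = 𝟎 ∷ 𝟏 ∷ []
0# = []
1# = C 𝟏

polyRawSemiring : RawSemiring 0ℓ 0ℓ
polyRawSemiring = record
  { Carrier = Poly ; _≈_ = _≈_ ; _+_ = _+_ ; _*_ = _*_ ; 0# = 0# ; 1# = 1# }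

open import Algebra.Definitions.RawSemiring polyRawSemiring public
  using (_∣_; _^_; product; Coprime; Irreducible)

open import Data.List.Membership.Setoid ≈-setoid public using (_∈_)
open import Data.List.Relation.Unary.Unique.Setoid ≈-setoid public using (Unique)

Monic : Pred Poly 0ℓ
Monic P = ∃ λ n → coeff P n ≡ 𝟏 × (∀ m → n < m → coeff P m ≡ 𝟎)

Nonconstant : Pred Poly 0ℓ
Nonconstant P = ∃ λ n → n ≥ 1 × coeff P n ≢ 𝟎

-- L lists the finite set {D : P D}, each element (up to ≈) exactly once.
Enumerates : List Poly → Pred Poly 0ℓ → Set
Enumerates L P = Unique L × (∀ D → D ∈ L ⇔ P D)

------------------------------------------------------------------------
-- Unitary and bi-unitary divisors

-- Below, Q is the cofactor S / D, which is unique up to ≈ as D is monic.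

UnitaryDivisor : Poly → Pred Poly 0ℓ
UnitaryDivisor S D = Monic D × ∃ λ Q → Q * D ≈ S × Coprime D Q

-- G = gcdᵤ(S,T), greatest with respect to divisibility.
IsGCDᵤ : Poly → Poly → Pred Poly 0ℓ
IsGCDᵤ S T G =
  UnitaryDivisor S G × UnitaryDivisor T G ×
  (∀ D → UnitaryDivisor S D → UnitaryDivisor T D → D ∣ G)

BiunitaryDivisor : Poly → Pred Poly 0ℓ
BiunitaryDivisor S D = Monic D × ∃ λ Q → Q * D ≈ S × IsGCDᵤ D Q 1#

infix 4 σ**[_]=_ ω[_]=_

-- σ** and ω, for a monic polynomial S, are given by their graphs: a finite
-- set is summed over, or counted, by means of a listing of its elements.

σ**[_]=_ : Poly → Poly → Set
σ**[ S ]= T = ∃ λ L → Enumerates L (BiunitaryDivisor S) × foldr _+_ 0# L ≈ T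

ω[_]=_ : Poly → ℕ → Set
ω[ S ]= n =
  ∃ λ L → Enumerates L (λ P → Monic P × Irreducible P × P ∣ S) × length L ≡ n

BiunitaryPerfect : Pred Poly 0ℓ
BiunitaryPerfect S = Monic S × σ**[ S ]= S

-- The factors A₀, …, Aᵣ are indexed by Fin (suc r).
TriviallyBiunitaryPerfect : Pred Poly 0ℓ
TriviallyBiunitaryPerfect A =
  BiunitaryPerfect A ×
  ∃ λ r → r ≥ 1 × ∃ λ (As : Vector Poly (suc r)) →
    A ≈ product As ×
    (∀ i → Nonconstant (As i) × BiunitaryPerfect (As i)) ×
    (∀ i j → i ≢ j → Coprime (As i) (As j))

------------------------------------------------------------------------
-- The families 𝒯 and Σ

𝒯 : Pred ℕ 0ℓ
𝒯 r = r ≥ 1 × (r ≡ 2 ⊎ ∃ λ n → n ≥ 1 × r ≡ 2 ℕ.^ n ℕ.∸ 1)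

infix 4 _∈Σ

_∈Σ : Pred Poly 0ℓ
A ∈Σ = ∃ λ r → 𝒯 r × (A ≈ (X ^ 2 + X) ^ r ⊎ A ≈ (X ^ 2 + X + 1#) ^ r)

{-# OPTIONS --safe #-}

-- For A = pᵃqᵇ with p, q distinct linear polynomials, σ** is multiplicative and σ**(pᵃ) is coprime to p,
-- so A = σ**(A) forces σ**(pᵃ) = qᵃ and a = b; in particular a perfect A ≠ 1 has at least two roots.
-- Write q = p + δ.  Modulo p², σ**(pᵃ) is 1 + p for a ≥ 3 while qᵃ is δᵃ + aδᵃ⁻¹p, so a is odd and δ = 1
-- (for a ≤ 2 also δ = 1).  For odd a the geometric sum turns σ**(pᵃ) = qᵃ into (p + 1)ᵃ⁺¹ = pᵃ⁺¹ + 1;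
-- extracting square roots and comparing modulo p² again, a + 1 is a power of 2.
-- In a trivially perfect A each coprime factor has at least two of the four roots in 𝔽₄, hence there are
-- exactly two factors, each with exactly two roots.

module Submission where

open import Defs
open import Algebra.Bundles using (CommutativeMonoid; CommutativeSemiring; RawSemiring)
open import Algebra.Definitions.RawMagma (RawSemiring.*-rawMagma polyRawSemiring) using (_,_)
open import Algebra.Structures.Biased using (isCommutativeSemiringˡ)
open import Algebra.Solver.Ring.AlmostCommutativeRing using (fromCommutativeSemiring; AlmostCommutativeRing; _-Raw-AlmostCommutative⟶_)
import Algebra.Properties.CommutativeSemigroup as CommutativeSemigroupProperties
import Algebra.Properties.CommutativeSemiring.Exp as CommutativeSemiringExp
import Algebra.Properties.Magma.Divisibility as MagmaDivisibility
import Algebra.Solver.Ring as RingSolver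
import Algebra.Solver.Ring.Simple as SimpleRingSolver
open import Data.Bool.Base using (if_then_else_)
open import Data.Empty using (⊥-elim)
open import Data.Fin.Base using (Fin; zero; suc)
open import Data.List.Base using (List; []; _∷_; _++_; map; foldr; filter; downFrom; cartesianProductWith)
open import Data.List.Membership.Propositional using () renaming (_∈_ to _∈ₚ_)
open import Data.List.Membership.Propositional.Properties using (∈-filter⁺; ∈-filter⁻; ∈-downFrom⁺; ∈-downFrom⁻)
open import Data.List.Membership.Setoid.Properties using (∈-resp-≈; ∈-cartesianProductWith⁺; ∈-cartesianProductWith⁻)
open import Data.List.Properties using (filter-accept; filter-all; filter-reject)
import Data.List.Relation.Binary.Permutation.Setoid ≈-setoid as ↭
open import Data.List.Relation.Binary.Permutation.Setoid.Properties ≈-setoid using (∈-resp-↭; Unique-resp-↭; foldr-commMonoid)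
open import Data.List.Relation.Unary.All using (universal)
open import Data.List.Relation.Unary.AllPairs using (tail)
open import Data.List.Relation.Unary.Any using (here; there)
open import Data.List.Relation.Unary.Unique.Propositional using () renaming (Unique to Uniqueₚ)
open import Data.List.Relation.Unary.Unique.Propositional.Properties using (downFrom⁺)
open import Data.List.Relation.Unary.Unique.Setoid.Properties using (filter⁺; cartesianProductWith⁺; Unique[x∷xs]⇒x∉xs)
open import Data.Nat.Base as ℕ using (ℕ; zero; suc; _≥_; _<_; _≤_; _∸_; z≤n; s≤s)
open import Data.Nat.Induction using (<-rec)
import Data.Nat.Properties as ℕₚ
open import Data.Product.Base using (_×_; ∃; ∃₂; _,_; proj₁; proj₂)
open import Data.Sum.Base using (_⊎_; inj₁; inj₂; [_,_]′; swap)
open import Data.Vec.Functional using (Vector)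
open import Function.Base using (_∘_; id; case_of_)
open import Function.Bundles using (_⇔_; mk⇔; module Equivalence)
open import Level using (0ℓ)
open import Relation.Binary.Bundles using (Setoid)
open import Relation.Binary.Consequences using (dec⇒weaklyDec)
open import Relation.Binary.Definitions using (DecidableEquality; tri<; tri≈; tri>)
open import Relation.Binary.PropositionalEquality using (_≡_; _≢_; _≗_; refl; sym; trans; cong; cong₂; subst; isMagma; module ≡-Reasoning) renaming (setoid to ≡-setoid)
import Relation.Binary.Reasoning.Setoid as SetoidReasoning
open import Relation.Nullary.Decidable using (toSum; decidable-stable; Dec; yes; no; does; dec-true; dec-false; map′; from-yes; _×-dec_; _→-dec_; _⊎-dec_; ¬?)
open import Relation.Nullary.Negation using (¬_; contradiction)
open import Relation.Unary using (Decidable)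

open ↭ using (_↭_)
open Equivalence using (to; from)

-- The field 𝔽₄

-- `A` splits over 𝔽₄, so its monic divisors are handled as exponent vectors `𝔽₄ → ℕ` through `∏`:
-- coprimality, unitarity and bi-unitarity become conditions on each exponent separately, and
-- valuations at the four points take the place of unique factorization. The obstacle is that σ** is
-- known only through some listing of the divisors. An explicit listing is built when the exponents
-- vanish off two points, and sums over two listings of the same set agree because the listings are
-- permutations of each other. Two points are enough: a polynomial with a sole root is read as a
-- pair with exponent 0 at a second point. Working modulo p² means keeping the value and the
-- derivative at the root of p, that is `eval` and `der`. For exponent 2 the divisor p itself is not
-- bi-unitary, so only values are compared there; this is the origin of the exceptional r = 2 in
-- `𝒯`.

code : 𝔽₄ → ℕ
code 𝟎   = 0
code 𝟏   = 1
code α   = 2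
code α+1 = 3

decode : ℕ → 𝔽₄
decode 0 = 𝟎
decode 1 = 𝟏
decode 2 = α
decode _ = α+1

decode-code : ∀ c → decode (code c) ≡ c
decode-code 𝟎   = refl
decode-code 𝟏   = refl
decode-code α   = refl
decode-code α+1 = refl

infix 4 _≟_

-- Transported from ℕ along the injection `code`.
_≟_ : DecidableEquality 𝔽₄
a ≟ b = map′ (λ e → trans (sym (decode-code a)) (trans (cong decode e) (decode-code b)))
             (cong code) (code a ℕₚ.≟ code b)

-- With `∀?` and `∃?`, statements quantified over 𝔽₄ are decidable, so the field axioms and similar
-- facts are proved by letting `from-yes` evaluate all cases.
∀? : {P : 𝔽₄ → Set} → Decidable P → Dec (∀ c → P c)
∀? {P} P? = map′ (λ (p , q , r , s) → λ { 𝟎 → p ; 𝟏 → q ; α → r ; α+1 → s })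
                 (λ f → f 𝟎 , f 𝟏 , f α , f α+1)
                 (P? 𝟎 ×-dec P? 𝟏 ×-dec P? α ×-dec P? α+1)

∃? : {P : 𝔽₄ → Set} → Decidable P → Dec (∃ P)
∃? P? = map′ (λ { (inj₁ x) → 𝟎 , x ; (inj₂ (inj₁ x)) → 𝟏 , x ; (inj₂ (inj₂ (inj₁ x))) → α , x ; (inj₂ (inj₂ (inj₂ x))) → α+1 , x })
             (λ { (𝟎 , x) → inj₁ x ; (𝟏 , x) → inj₂ (inj₁ x) ; (α , x) → inj₂ (inj₂ (inj₁ x)) ; (α+1 , x) → inj₂ (inj₂ (inj₂ x)) })
             (P? 𝟎 ⊎-dec P? 𝟏 ⊎-dec P? α ⊎-dec P? α+1)

+₄-comm : ∀ a b → a +₄ b ≡ b +₄ a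
+₄-comm = from-yes (∀? λ a → ∀? λ b → a +₄ b ≟ b +₄ a)

+₄-assoc : ∀ a b c → (a +₄ b) +₄ c ≡ a +₄ (b +₄ c)
+₄-assoc = from-yes (∀? λ a → ∀? λ b → ∀? λ c → (a +₄ b) +₄ c ≟ a +₄ (b +₄ c))

+₄-identityʳ : ∀ a → a +₄ 𝟎 ≡ a
+₄-identityʳ = from-yes (∀? λ a → a +₄ 𝟎 ≟ a)

+₄-self : ∀ a → a +₄ a ≡ 𝟎
+₄-self = from-yes (∀? λ a → a +₄ a ≟ 𝟎)

+₄≡𝟎⇒≡ : ∀ a b → a +₄ b ≡ 𝟎 → a ≡ b
+₄≡𝟎⇒≡ = from-yes (∀? λ a → ∀? λ b → (a +₄ b ≟ 𝟎) →-dec (a ≟ b))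

*₄-comm : ∀ a b → a *₄ b ≡ b *₄ a
*₄-comm = from-yes (∀? λ a → ∀? λ b → a *₄ b ≟ b *₄ a)

*₄-assoc : ∀ a b c → (a *₄ b) *₄ c ≡ a *₄ (b *₄ c)
*₄-assoc = from-yes (∀? λ a → ∀? λ b → ∀? λ c → (a *₄ b) *₄ c ≟ a *₄ (b *₄ c))

*₄-identityʳ : ∀ a → a *₄ 𝟏 ≡ a
*₄-identityʳ = from-yes (∀? λ a → a *₄ 𝟏 ≟ a)

*₄-zeroʳ : ∀ a → a *₄ 𝟎 ≡ 𝟎
*₄-zeroʳ = from-yes (∀? λ a → a *₄ 𝟎 ≟ 𝟎)

*₄-distribˡ-+₄ : ∀ a b c → a *₄ (b +₄ c) ≡ a *₄ b +₄ a *₄ c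
*₄-distribˡ-+₄ = from-yes (∀? λ a → ∀? λ b → ∀? λ c → a *₄ (b +₄ c) ≟ a *₄ b +₄ a *₄ c)

*₄-distribʳ-+₄ : ∀ a b c → (b +₄ c) *₄ a ≡ b *₄ a +₄ c *₄ a
*₄-distribʳ-+₄ = from-yes (∀? λ a → ∀? λ b → ∀? λ c → (b +₄ c) *₄ a ≟ b *₄ a +₄ c *₄ a)

*₄≡𝟎 : ∀ a b → a *₄ b ≡ 𝟎 → a ≡ 𝟎 ⊎ b ≡ 𝟎
*₄≡𝟎 = from-yes (∀? λ a → ∀? λ b → (a *₄ b ≟ 𝟎) →-dec ((a ≟ 𝟎) ⊎-dec (b ≟ 𝟎)))

*₄-nonzero : ∀ {a b} → a ≢ 𝟎 → b ≢ 𝟎 → a *₄ b ≢ 𝟎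
*₄-nonzero {a} {b} a≢𝟎 b≢𝟎 ab≡𝟎 with *₄≡𝟎 a b ab≡𝟎
... | inj₁ a≡𝟎 = a≢𝟎 a≡𝟎
... | inj₂ b≡𝟎 = b≢𝟎 b≡𝟎

-- The multiplicative group has order 3, so squaring inverts each nonzero element.
inverse : 𝔽₄ → 𝔽₄
inverse c = c *₄ c

*₄-inverseˡ : ∀ c → c ≢ 𝟎 → inverse c *₄ c ≡ 𝟏
*₄-inverseˡ = from-yes (∀? λ c → ¬? (c ≟ 𝟎) →-dec (inverse c *₄ c ≟ 𝟏))

𝔽₄-commutativeSemiring : CommutativeSemiring 0ℓ 0ℓ
𝔽₄-commutativeSemiring = record
  { Carrier = 𝔽₄ ; _≈_ = _≡_ ; _+_ = _+₄_ ; _*_ = _*₄_ ; 0# = 𝟎 ; 1# = 𝟏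
  ; isCommutativeSemiring = isCommutativeSemiringˡ record
    { +-isCommutativeMonoid = record
      { isMonoid = record
        { isSemigroup = record
          { isMagma = isMagma _+₄_
          ; assoc   = +₄-assoc
          }
        ; identity = (λ _ → refl) , +₄-identityʳ
        }
      ; comm = +₄-comm
      }
    ; *-isCommutativeMonoid = record
      { isMonoid = record
        { isSemigroup = record
          { isMagma = isMagma _*₄_
          ; assoc   = *₄-assoc
          }
        ; identity = (λ _ → refl) , *₄-identityʳ
        }
      ; comm = *₄-comm
      }
    ; distribʳ = *₄-distribʳ-+₄
    ; zeroˡ    = λ _ → refl
    }
  }

𝔽₄-ring : AlmostCommutativeRing 0ℓ 0ℓ
𝔽₄-ring = fromCommutativeSemiring 𝔽₄-commutativeSemiring

module 𝔽₄-Solver = SimpleRingSolver 𝔽₄-ring _≟_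

-- The commutative semiring 𝔽₄[x]

open Setoid ≈-setoid using () renaming (refl to ≈-refl; sym to ≈-sym; trans to ≈-trans)
module ≈-Reasoning = SetoidReasoning ≈-setoid

infixr 7.5 _·_

_·_ : 𝔽₄ → Poly → Poly
a · p = map (a *₄_) p

coeff-+ : ∀ p q i → coeff (p + q) i ≡ coeff p i +₄ coeff q i
coeff-+ []      q       i       = refl
coeff-+ (a ∷ p) []      i       = sym (+₄-identityʳ _)
coeff-+ (a ∷ p) (b ∷ q) zero    = refl
coeff-+ (a ∷ p) (b ∷ q) (suc i) = coeff-+ p q i

coeff-· : ∀ a p i → coeff (a · p) i ≡ a *₄ coeff p i
coeff-· a []      i       = sym (*₄-zeroʳ a)
coeff-· a (b ∷ p) zero    = refl
coeff-· a (b ∷ p) (suc i) = coeff-· a p i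

∷-cong : ∀ {a b p q} → a ≡ b → p ≈ q → a ∷ p ≈ b ∷ q
∷-cong a≡b p≈q = mk≈ λ { zero → a≡b ; (suc i) → coeff≗ p≈q i }

tail-cong : ∀ {a b p q} → a ∷ p ≈ b ∷ q → p ≈ q
tail-cong e = mk≈ (coeff≗ e ∘ suc)

tail-zero : ∀ {a p} → a ∷ p ≈ [] → p ≈ []
tail-zero e = mk≈ (coeff≗ e ∘ suc)

+-cong : ∀ {p p′ q q′} → p ≈ p′ → q ≈ q′ → p + q ≈ p′ + q′
+-cong {p} {p′} {q} {q′} e f = mk≈ λ i → trans (coeff-+ p q i)
  (trans (cong₂ _+₄_ (coeff≗ e i) (coeff≗ f i)) (sym (coeff-+ p′ q′ i)))

+-assoc : ∀ p q r → (p + q) + r ≈ p + (q + r)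
+-assoc []      q       r       = ≈-refl
+-assoc (a ∷ p) []      r       = ≈-refl
+-assoc (a ∷ p) (b ∷ q) []      = ≈-refl
+-assoc (a ∷ p) (b ∷ q) (c ∷ r) = ∷-cong (+₄-assoc a b c) (+-assoc p q r)

+-comm : ∀ p q → p + q ≈ q + p
+-comm p q = mk≈ λ i → trans (coeff-+ p q i) (trans (+₄-comm (coeff p i) (coeff q i)) (sym (coeff-+ q p i)))

+-identityʳ : ∀ p → p + [] ≈ p
+-identityʳ []      = ≈-refl
+-identityʳ (a ∷ p) = ≈-refl

+-commutativeMonoid : CommutativeMonoid 0ℓ 0ℓ
+-commutativeMonoid = record
  { Carrier = Poly ; _≈_ = _≈_ ; _∙_ = _+_ ; ε = 0#
  ; isCommutativeMonoid = record
    { isMonoid = record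
      { isSemigroup = record
        { isMagma = record { isEquivalence = Setoid.isEquivalence ≈-setoid ; ∙-cong = +-cong }
        ; assoc   = +-assoc
        }
      ; identity = (λ _ → ≈-refl) , +-identityʳ
      }
    ; comm = +-comm
    }
  }

open CommutativeSemigroupProperties (CommutativeMonoid.commutativeSemigroup +-commutativeMonoid)
  using () renaming (interchange to +-interchange; x∙yz≈y∙xz to +-left-comm)

·-cong : ∀ {a b p q} → a ≡ b → p ≈ q → a · p ≈ b · q
·-cong {a} {b} {p} {q} e f = mk≈ λ i →
  trans (coeff-· a p i) (trans (cong₂ _*₄_ e (coeff≗ f i)) (sym (coeff-· b q i)))

𝟎∷[] : 𝟎 ∷ [] ≈ []
𝟎∷[] = mk≈ λ { zero → refl ; (suc i) → refl }

𝟎·-zero : ∀ p → 𝟎 · p ≈ []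
𝟎·-zero p = mk≈ (coeff-· 𝟎 p)

𝟏·-identity : ∀ p → 𝟏 · p ≈ p
𝟏·-identity p = mk≈ (coeff-· 𝟏 p)

·-distribˡ-+ : ∀ a p q → a · (p + q) ≈ a · p + a · q
·-distribˡ-+ a []      q       = ≈-refl
·-distribˡ-+ a (b ∷ p) []      = ≈-refl
·-distribˡ-+ a (b ∷ p) (c ∷ q) = ∷-cong (*₄-distribˡ-+₄ a b c) (·-distribˡ-+ a p q)

·-distribʳ-+ : ∀ a b p → (a +₄ b) · p ≈ a · p + b · p
·-distribʳ-+ a b []      = ≈-refl
·-distribʳ-+ a b (c ∷ p) = ∷-cong (*₄-distribʳ-+₄ c a b) (·-distribʳ-+ a b p)

·-assoc : ∀ a b p → (a *₄ b) · p ≈ a · b · p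
·-assoc a b []      = ≈-refl
·-assoc a b (c ∷ p) = ∷-cong (*₄-assoc a b c) (·-assoc a b p)

-- Lists of different lengths may be equal as polynomials; in the induction for `*-cong` one list
-- can end while the other continues with zeros, and this lemma absorbs that remainder.
*-congʳ-zero : ∀ {p} → p ≈ [] → ∀ q → p * q ≈ []
*-congʳ-zero {[]}    p≈[] q = ≈-refl
*-congʳ-zero {a ∷ p} p≈[] q = begin
  a · q + (𝟎 ∷ p * q)  ≈⟨ +-cong (·-cong (coeff≗ p≈[] 0) (≈-refl {q})) (∷-cong refl (*-congʳ-zero (tail-zero p≈[]) q)) ⟩
  𝟎 · q + (𝟎 ∷ [])     ≈⟨ +-cong (𝟎·-zero q) 𝟎∷[] ⟩
  []                   ∎
  where open ≈-Reasoning

*-cong : ∀ {p p′ q q′} → p ≈ p′ → q ≈ q′ → p * q ≈ p′ * q′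
*-cong {[]}    {p′}     {q} {q′} e f = ≈-sym (*-congʳ-zero (≈-sym e) q′)
*-cong {a ∷ p} {[]}     {q} {q′} e f = *-congʳ-zero e q
*-cong {a ∷ p} {b ∷ p′} {q} {q′} e f =
  +-cong (·-cong (coeff≗ e 0) f) (∷-cong refl (*-cong (tail-cong e) f))

*-distribʳ-+ : ∀ r p q → (p + q) * r ≈ p * r + q * r
*-distribʳ-+ r []      q       = ≈-refl
*-distribʳ-+ r (a ∷ p) []      = ≈-sym (+-identityʳ _)
*-distribʳ-+ r (a ∷ p) (b ∷ q) = begin
  (a +₄ b) · r + (𝟎 ∷ (p + q) * r)              ≈⟨ +-cong (·-distribʳ-+ a b r) (∷-cong refl (*-distribʳ-+ r p q)) ⟩
  (a · r + b · r) + (𝟎 ∷ (p * r + q * r))       ≈⟨ +-interchange (a · r) (b · r) (𝟎 ∷ p * r) (𝟎 ∷ q * r) ⟩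
  (a · r + (𝟎 ∷ p * r)) + (b · r + (𝟎 ∷ q * r)) ∎
  where open ≈-Reasoning

*-zeroʳ : ∀ p → p * [] ≈ []
*-zeroʳ []      = ≈-refl
*-zeroʳ (a ∷ p) = ≈-trans (∷-cong refl (*-zeroʳ p)) 𝟎∷[]

-- The recursion equation of `_*_` mirrored to the right argument, from which commutativity follows
-- by induction.
*-∷ʳ : ∀ p b q → p * (b ∷ q) ≈ b · p + (𝟎 ∷ p * q)
*-∷ʳ []      b q = ≈-sym 𝟎∷[]
*-∷ʳ (a ∷ p) b q = ∷-cong (cong (_+₄ 𝟎) (*₄-comm a b)) (begin
  a · q + p * (b ∷ q)          ≈⟨ +-cong ≈-refl (*-∷ʳ p b q) ⟩
  a · q + (b · p + (𝟎 ∷ p * q)) ≈⟨ +-left-comm (a · q) (b · p) (𝟎 ∷ p * q) ⟩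
  b · p + (a · q + (𝟎 ∷ p * q)) ∎)
  where open ≈-Reasoning

*-comm : ∀ p q → p * q ≈ q * p
*-comm []      q = ≈-sym (*-zeroʳ q)
*-comm (a ∷ p) q = ≈-trans (+-cong ≈-refl (∷-cong refl (*-comm p q))) (≈-sym (*-∷ʳ q a p))

·-*-assoc : ∀ a p q → (a · p) * q ≈ a · (p * q)
·-*-assoc a []      q = ≈-refl
·-*-assoc a (b ∷ p) q = begin
  (a *₄ b) · q + (𝟎 ∷ (a · p) * q)       ≈⟨ +-cong (·-assoc a b q) (∷-cong (sym (*₄-zeroʳ a)) (·-*-assoc a p q)) ⟩
  a · b · q + (a *₄ 𝟎 ∷ a · (p * q))     ≈⟨ ·-distribˡ-+ a (b · q) (𝟎 ∷ p * q) ⟨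
  a · (b · q + (𝟎 ∷ p * q))              ∎
  where open ≈-Reasoning

𝟎∷-* : ∀ p q → (𝟎 ∷ p) * q ≈ 𝟎 ∷ p * q
𝟎∷-* p q = +-cong (𝟎·-zero q) ≈-refl

*-assoc : ∀ p q r → (p * q) * r ≈ p * (q * r)
*-assoc []      q r = ≈-refl
*-assoc (a ∷ p) q r = begin
  (a · q + (𝟎 ∷ p * q)) * r         ≈⟨ *-distribʳ-+ r (a · q) (𝟎 ∷ p * q) ⟩
  (a · q) * r + (𝟎 ∷ p * q) * r     ≈⟨ +-cong (·-*-assoc a q r) (𝟎∷-* (p * q) r) ⟩
  a · (q * r) + (𝟎 ∷ (p * q) * r)   ≈⟨ +-cong ≈-refl (∷-cong refl (*-assoc p q r)) ⟩
  a · (q * r) + (𝟎 ∷ p * (q * r))   ∎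
  where open ≈-Reasoning

C-* : ∀ a p → C a * p ≈ a · p
C-* a p = ≈-trans (+-cong ≈-refl 𝟎∷[]) (+-identityʳ _)

*-identityˡ : ∀ p → 1# * p ≈ p
*-identityˡ p = ≈-trans (C-* 𝟏 p) (𝟏·-identity p)

polyCommutativeSemiring : CommutativeSemiring 0ℓ 0ℓ
polyCommutativeSemiring = record
  { Carrier = Poly ; _≈_ = _≈_ ; _+_ = _+_ ; _*_ = _*_ ; 0# = 0# ; 1# = 1#
  ; isCommutativeSemiring = isCommutativeSemiringˡ record
    { +-isCommutativeMonoid = CommutativeMonoid.isCommutativeMonoid +-commutativeMonoid
    ; *-isCommutativeMonoid = record
      { isMonoid = record
        { isSemigroup = record
          { isMagma = record { isEquivalence = Setoid.isEquivalence ≈-setoid ; ∙-cong = *-cong }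
          ; assoc   = *-assoc
          }
        ; identity = *-identityˡ , λ p → ≈-trans (*-comm p 1#) (*-identityˡ p)
        }
      ; comm = *-comm
      }
    ; distribʳ = *-distribʳ-+
    ; zeroˡ    = λ _ → ≈-refl
    }
  }

open CommutativeSemiringExp polyCommutativeSemiring
  using (^-congˡ; ^-congʳ; ^-homo-*; ^-distrib-*)
open CommutativeSemiring polyCommutativeSemiring using (distribˡ; *-identityʳ; *-congˡ; *-congʳ; +-congˡ; +-congʳ)

open MagmaDivisibility (CommutativeSemiring.*-magma polyCommutativeSemiring) using (∣-respˡ; ∣-respʳ)

polyRing : AlmostCommutativeRing 0ℓ 0ℓ
polyRing = fromCommutativeSemiring polyCommutativeSemiring

-- With coefficients in 𝔽₄ the solver knows that the characteristic is 2.
C-homomorphism : AlmostCommutativeRing.rawRing 𝔽₄-ring -Raw-AlmostCommutative⟶ polyRing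
C-homomorphism = record
  { ⟦_⟧    = C
  ; +-homo = λ _ _ → ≈-refl
  ; *-homo = λ a b → ∷-cong (sym (+₄-identityʳ _)) ≈-refl
  ; -‿homo = λ _ → ≈-refl
  ; 0-homo = 𝟎∷[]
  ; 1-homo = ≈-refl
  }

module Poly-Solver = RingSolver (AlmostCommutativeRing.rawRing 𝔽₄-ring) polyRing C-homomorphism
  (dec⇒weaklyDec (λ a b → map′ (λ e → ∷-cong e ≈-refl) (λ e → coeff≗ e 0) (a ≟ b)))

-- Evaluation and derivative at a point

eval : 𝔽₄ → Poly → 𝔽₄
eval t []      = 𝟎
eval t (a ∷ p) = a +₄ t *₄ eval t p

eval-zero : ∀ t {p} → p ≈ [] → eval t p ≡ 𝟎
eval-zero t {[]}    e = refl
eval-zero t {a ∷ p} e = trans (cong₂ (λ u v → u +₄ t *₄ v) (coeff≗ e 0) (eval-zero t (tail-zero e))) (*₄-zeroʳ t)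

eval-cong : ∀ t {p q} → p ≈ q → eval t p ≡ eval t q
eval-cong t {[]}    {q}     e = sym (eval-zero t (≈-sym e))
eval-cong t {a ∷ p} {[]}    e = eval-zero t e
eval-cong t {a ∷ p} {b ∷ q} e = cong₂ (λ u v → u +₄ t *₄ v) (coeff≗ e 0) (eval-cong t (tail-cong e))

eval-+ : ∀ t p q → eval t (p + q) ≡ eval t p +₄ eval t q
eval-+ t []      q       = refl
eval-+ t (a ∷ p) []      = sym (+₄-identityʳ _)
eval-+ t (a ∷ p) (b ∷ q) = trans (cong (λ u → (a +₄ b) +₄ t *₄ u) (eval-+ t p q))
  (solve 5 (λ a b t u v → (a :+ b) :+ t :* (u :+ v) := (a :+ t :* u) :+ (b :+ t :* v)) refl a b t (eval t p) (eval t q))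
  where open 𝔽₄-Solver

eval-· : ∀ t a p → eval t (a · p) ≡ a *₄ eval t p
eval-· t a []      = sym (*₄-zeroʳ a)
eval-· t a (b ∷ p) = trans (cong (λ u → a *₄ b +₄ t *₄ u) (eval-· t a p))
  (solve 4 (λ a b t u → a :* b :+ t :* (a :* u) := a :* (b :+ t :* u)) refl a b t (eval t p))
  where open 𝔽₄-Solver

eval-* : ∀ t p q → eval t (p * q) ≡ eval t p *₄ eval t q
eval-* t []      q = refl
eval-* t (a ∷ p) q = begin
  eval t (a · q + (𝟎 ∷ p * q))                      ≡⟨ eval-+ t (a · q) (𝟎 ∷ p * q) ⟩
  eval t (a · q) +₄ t *₄ eval t (p * q)              ≡⟨ cong₂ (λ u v → u +₄ t *₄ v) (eval-· t a q) (eval-* t p q) ⟩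
  a *₄ eval t q +₄ t *₄ (eval t p *₄ eval t q)       ≡⟨ solve 4 (λ a t u v → a :* v :+ t :* (u :* v) := (a :+ t :* u) :* v) refl a t (eval t p) (eval t q) ⟩
  (a +₄ t *₄ eval t p) *₄ eval t q                   ∎
  where
  open ≡-Reasoning
  open 𝔽₄-Solver using (solve; _:=_; _:+_; _:*_)

eval-1# : ∀ t → eval t 1# ≡ 𝟏
eval-1# = from-yes (∀? λ t → eval t 1# ≟ 𝟏)

-- Horner's rule differentiated: the derivative of a + x p is p + x p′. Value and derivative at t
-- together determine the residue modulo the square of `linear t`.
der : 𝔽₄ → Poly → 𝔽₄
der t []      = 𝟎
der t (a ∷ p) = eval t p +₄ t *₄ der t p

der-zero : ∀ t {p} → p ≈ [] → der t p ≡ 𝟎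
der-zero t {[]}    e = refl
der-zero t {a ∷ p} e = trans (cong₂ (λ u v → u +₄ t *₄ v) (eval-zero t (tail-zero e)) (der-zero t (tail-zero e))) (*₄-zeroʳ t)

der-cong : ∀ t {p q} → p ≈ q → der t p ≡ der t q
der-cong t {[]}    {q}     e = sym (der-zero t (≈-sym e))
der-cong t {a ∷ p} {[]}    e = der-zero t e
der-cong t {a ∷ p} {b ∷ q} e = cong₂ (λ u v → u +₄ t *₄ v) (eval-cong t (tail-cong e)) (der-cong t (tail-cong e))

der-+ : ∀ t p q → der t (p + q) ≡ der t p +₄ der t q
der-+ t []      q       = refl
der-+ t (a ∷ p) []      = sym (+₄-identityʳ _)
der-+ t (a ∷ p) (b ∷ q) = trans (cong₂ (λ u v → u +₄ t *₄ v) (eval-+ t p q) (der-+ t p q))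
  (solve 5 (λ a b t u v → (a :+ b) :+ t :* (u :+ v) := (a :+ t :* u) :+ (b :+ t :* v)) refl (eval t p) (eval t q) t (der t p) (der t q))
  where open 𝔽₄-Solver

der-· : ∀ t a p → der t (a · p) ≡ a *₄ der t p
der-· t a []      = sym (*₄-zeroʳ a)
der-· t a (b ∷ p) = trans (cong₂ (λ u v → u +₄ t *₄ v) (eval-· t a p) (der-· t a p))
  (solve 4 (λ a b t u → a :* b :+ t :* (a :* u) := a :* (b :+ t :* u)) refl a (eval t p) t (der t p))
  where open 𝔽₄-Solver

der-* : ∀ t p q → der t (p * q) ≡ der t p *₄ eval t q +₄ eval t p *₄ der t q
der-* t []      q = refl
der-* t (a ∷ p) q = begin
  der t (a · q + (𝟎 ∷ p * q))
    ≡⟨ der-+ t (a · q) (𝟎 ∷ p * q) ⟩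
  der t (a · q) +₄ (eval t (p * q) +₄ t *₄ der t (p * q))
    ≡⟨ cong₂ _+₄_ (der-· t a q) (cong₂ (λ u v → u +₄ t *₄ v) (eval-* t p q) (der-* t p q)) ⟩
  a *₄ q′ +₄ (eval t p *₄ eval t q +₄ t *₄ (der t p *₄ eval t q +₄ eval t p *₄ q′))
    ≡⟨ solve 6 (λ a t u u′ v v′ → a :* v′ :+ (u :* v :+ t :* (u′ :* v :+ u :* v′)) := (u :+ t :* u′) :* v :+ (a :+ t :* u) :* v′)
         refl a t (eval t p) (der t p) (eval t q) q′ ⟩
  (eval t p +₄ t *₄ der t p) *₄ eval t q +₄ (a +₄ t *₄ eval t p) *₄ q′
    ∎
  where
  open ≡-Reasoning
  open 𝔽₄-Solver using (solve; _:=_; _:+_; _:*_)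
  q′ : 𝔽₄
  q′ = der t q

-- Linear factors

-- Opaque, since otherwise products with linear factors unfold.
opaque

  linear : 𝔽₄ → Poly
  linear c = X + C c

  eval-linear : ∀ t c → eval t (linear c) ≡ t +₄ c
  eval-linear = from-yes (∀? λ t → ∀? λ c → eval t (linear c) ≟ t +₄ c)

  der-linear : ∀ t c → der t (linear c) ≡ 𝟏
  der-linear = from-yes (∀? λ t → ∀? λ c → der t (linear c) ≟ 𝟏)

eval-linear-self : ∀ c → eval c (linear c) ≡ 𝟎
eval-linear-self c = trans (eval-linear c c) (+₄-self c)

-- Horner's scheme: the intermediate values of the evaluation are the coefficients of the quotient.
quotient : 𝔽₄ → Poly → Poly
quotient c []      = []
quotient c (a ∷ p) = eval c p ∷ quotient c p

opaque
  unfolding linear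

  linear-∷ : ∀ c b p → linear c * (b ∷ p) ≈ (c *₄ b) ∷ (C b + linear c * p)
  linear-∷ c b p = begin
    linear c * (b ∷ p)                            ≈⟨ *-∷ʳ (linear c) b p ⟩
    b · linear c + (𝟎 ∷ linear c * p)             ≈⟨ ∷-cong (trans (+₄-identityʳ _) (*₄-comm b c)) (+-cong {C (b *₄ 𝟏)} {C b} (∷-cong (*₄-identityʳ b) ≈-refl) (≈-refl {linear c * p})) ⟩
    (c *₄ b) ∷ (C b + linear c * p)               ∎
    where open ≈-Reasoning

division : ∀ c p → p ≈ linear c * quotient c p + C (eval c p)
division c []      = ≈-sym (≈-trans (+-cong (*-zeroʳ (linear c)) 𝟎∷[]) ≈-refl)
division c (a ∷ p) = begin
  a ∷ p
    ≈⟨ ∷-cong refl (division c p) ⟩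
  a ∷ (linear c * quotient c p + C v)
    -- In characteristic 2 the term `c *₄ v` may be inserted twice: one copy completes the product
    -- with `linear c`, the other the remainder.
    ≈⟨ ∷-cong (solve 3 (λ a c v → a := c :* v :+ (a :+ c :* v)) refl a c v)
              (≈-trans (+-comm (linear c * quotient c p) (C v)) (≈-sym (+-identityʳ _))) ⟩
  ((c *₄ v) ∷ (C v + linear c * quotient c p)) + C (a +₄ c *₄ v)
    ≈⟨ +-congʳ {C (a +₄ c *₄ v)} (linear-∷ c v (quotient c p)) ⟨
  linear c * (v ∷ quotient c p) + C (a +₄ c *₄ v)
    ∎
  where
  open ≈-Reasoning
  open 𝔽₄-Solver using (solve; _:=_; _:+_; _:*_)
  v : 𝔽₄
  v = eval c p

factor-theorem : ∀ c p → eval c p ≡ 𝟎 → p ≈ linear c * quotient c p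
factor-theorem c p e = begin
  p                                         ≈⟨ division c p ⟩
  linear c * quotient c p + C (eval c p)    ≈⟨ +-congˡ {linear c * quotient c p} (≈-trans (∷-cong e ≈-refl) 𝟎∷[]) ⟩
  linear c * quotient c p + []              ≈⟨ +-identityʳ _ ⟩
  linear c * quotient c p                   ∎
  where open ≈-Reasoning

-- Degrees

-- The leading coefficient is an index so that one comparison by `HasDegree-unique` yields both an
-- equation of degrees and an equation of scalars.
record HasDegree (p : Poly) (n : ℕ) (u : 𝔽₄) : Set where
  constructor hasDegree
  field
    leading : coeff p n ≡ u
    nonzero : u ≢ 𝟎
    above   : ∀ m → n < m → coeff p m ≡ 𝟎

open HasDegree

HasDegree-cong : ∀ {p q n u} → p ≈ q → HasDegree p n u → HasDegree q n u
HasDegree-cong e d = hasDegree (trans (sym (coeff≗ e _)) (leading d)) (nonzero d)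
  (λ m n<m → trans (sym (coeff≗ e m)) (above d m n<m))

HasDegree-unique : ∀ {p n m u v} → HasDegree p n u → HasDegree p m v → n ≡ m × u ≡ v
HasDegree-unique {n = n} {m} d e with ℕₚ.<-cmp n m
... | tri< n<m _ _ = contradiction (trans (sym (leading e)) (above d m n<m)) (nonzero e)
... | tri≈ _ refl _ = refl , trans (sym (leading d)) (leading e)
... | tri> _ _ m<n = contradiction (trans (sym (leading d)) (above e n m<n)) (nonzero d)

degree? : ∀ p → p ≈ [] ⊎ ∃₂ (HasDegree p)
degree? []      = inj₁ ≈-refl
degree? (a ∷ p) with degree? p
... | inj₂ (n , u , d) = inj₂ (suc n , u , hasDegree (leading d) (nonzero d) λ { (suc m) (s≤s n<m) → above d m n<m })
... | inj₁ p≈[] with a ≟ 𝟎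
...   | yes refl = inj₁ (≈-trans (∷-cong refl p≈[]) 𝟎∷[])
...   | no a≢𝟎  = inj₂ (0 , a , hasDegree refl a≢𝟎 λ { (suc m) _ → coeff≗ p≈[] m })

HasDegree-* : ∀ {p q n m u v} → HasDegree p n u → HasDegree q m v → HasDegree (p * q) (n ℕ.+ m) (u *₄ v)
HasDegree-* {[]} d e = contradiction (sym (leading d)) (nonzero d)
HasDegree-* {a ∷ p} {q} {zero} {m} {u} {v} (hasDegree refl a≢𝟎 above-0) e = HasDegree-cong a·q≈ap*q (hasDegree
  (trans (coeff-· a q m) (cong (a *₄_) (leading e)))
  (*₄-nonzero a≢𝟎 (nonzero e))
  (λ k m<k → trans (coeff-· a q k) (trans (cong (a *₄_) (above e k m<k)) (*₄-zeroʳ a))))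
  where
  p≈[] : p ≈ []
  p≈[] = mk≈ λ i → above-0 (suc i) (s≤s z≤n)
  a·q≈ap*q : a · q ≈ (a ∷ p) * q
  a·q≈ap*q = ≈-sym (≈-trans (+-congˡ (≈-trans (∷-cong refl (*-congʳ-zero p≈[] q)) 𝟎∷[])) (+-identityʳ _))
HasDegree-* {a ∷ p} {q} {suc n} {m} {u} {v} d e = hasDegree
  (trans (coeff-tail (n ℕ.+ m) (ℕₚ.m≤n+m m n)) (leading ih)) (nonzero ih)
  λ { (suc k) (s≤s n+m<k) → trans (coeff-tail k (ℕₚ.≤-trans (ℕₚ.m≤n+m m n) (ℕₚ.<⇒≤ n+m<k))) (above ih k n+m<k) }
  where
  ih : HasDegree (p * q) (n ℕ.+ m) (u *₄ v)
  ih = HasDegree-* {p} (hasDegree (leading d) (nonzero d) λ k n<k → above d (suc k) (s≤s n<k)) e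
  -- Above degree m the summand `a · q` contributes nothing, so the top coefficients come from the
  -- shifted `p * q`.
  coeff-tail : ∀ k → m ≤ k → coeff ((a ∷ p) * q) (suc k) ≡ coeff (p * q) k
  coeff-tail k m≤k = begin
    coeff (a · q + (𝟎 ∷ p * q)) (suc k)       ≡⟨ coeff-+ (a · q) (𝟎 ∷ p * q) (suc k) ⟩
    coeff (a · q) (suc k) +₄ coeff (p * q) k  ≡⟨ cong (_+₄ coeff (p * q) k) (trans (coeff-· a q (suc k)) (trans (cong (a *₄_) (above e (suc k) (s≤s m≤k))) (*₄-zeroʳ a))) ⟩
    coeff (p * q) k                           ∎
    where open ≡-Reasoning

HasDegree⇒≉0# : ∀ {p n u} → HasDegree p n u → ¬ p ≈ []
HasDegree⇒≉0# d p≈[] = nonzero d (trans (sym (leading d)) (coeff≗ p≈[] _))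

HasDegree-C : ∀ {u} → u ≢ 𝟎 → HasDegree (C u) 0 u
HasDegree-C u≢𝟎 = hasDegree refl u≢𝟎 λ { (suc m) _ → refl }

HasDegree-zero : ∀ {p u} → HasDegree p 0 u → p ≈ C u
HasDegree-zero d = mk≈ λ { zero → leading d ; (suc i) → above d (suc i) (s≤s z≤n) }

opaque
  unfolding linear

  HasDegree-linear : ∀ c → HasDegree (linear c) 1 𝟏
  HasDegree-linear c = hasDegree refl (λ ()) λ { (suc zero) (s≤s ()) ; (suc (suc m)) _ → refl }

HasDegree-^ : ∀ {p n} k → HasDegree p n 𝟏 → HasDegree (p ^ k) (k ℕ.* n) 𝟏
HasDegree-^ zero    d = HasDegree-C (λ ())
HasDegree-^ (suc k) d = HasDegree-* d (HasDegree-^ k d)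

HasDegree-linear^ : ∀ c k → HasDegree (linear c ^ k) k 𝟏
HasDegree-linear^ c k = subst (λ n → HasDegree (linear c ^ k) n 𝟏) (ℕₚ.*-identityʳ k) (HasDegree-^ k (HasDegree-linear c))

monic⇒HasDegree : ∀ {p} → Monic p → ∃ λ n → HasDegree p n 𝟏
monic⇒HasDegree (n , lead , above-n) = n , hasDegree lead (λ ()) above-n

HasDegree⇒monic : ∀ {p n} → HasDegree p n 𝟏 → Monic p
HasDegree⇒monic d = _ , leading d , above d

*≈0# : ∀ p q → p * q ≈ [] → p ≈ [] ⊎ q ≈ []
*≈0# p q e with degree? p | degree? q
... | inj₁ p≈[] | _ = inj₁ p≈[]
... | inj₂ _ | inj₁ q≈[] = inj₂ q≈[]
... | inj₂ (_ , _ , d) | inj₂ (_ , _ , d′) = contradiction e (HasDegree⇒≉0# (HasDegree-* d d′))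

+-self : ∀ p → p + p ≈ []
+-self p = mk≈ λ i → trans (coeff-+ p p i) (+₄-self (coeff p i))

+≈0#⇒≈ : ∀ p q → p + q ≈ [] → p ≈ q
+≈0#⇒≈ p q e = mk≈ λ i → +₄≡𝟎⇒≡ _ _ (trans (sym (coeff-+ p q i)) (coeff≗ e i))

*-cancelˡ-linear : ∀ c p q → linear c * p ≈ linear c * q → p ≈ q
*-cancelˡ-linear c p q e with *≈0# (linear c) (p + q) (begin
    linear c * (p + q)             ≈⟨ distribˡ (linear c) p q ⟩
    linear c * p + linear c * q    ≈⟨ +-congʳ {linear c * q} e ⟩
    linear c * q + linear c * q    ≈⟨ +-self (linear c * q) ⟩
    []                             ∎)
  where open ≈-Reasoning
... | inj₁ l≈[] = contradiction l≈[] (HasDegree⇒≉0# (HasDegree-linear c))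
... | inj₂ p+q≈[] = +≈0#⇒≈ p q p+q≈[]

-- Squaring is additive in characteristic 2, so equal squares give a sum whose square is zero, and
-- there are no zero divisors.
square-injective : ∀ p q → p * p ≈ q * q → p ≈ q
square-injective p q e with *≈0# (p + q) (p + q) (begin
    (p + q) * (p + q)    ≈⟨ solve 2 (λ p q → (p :+ q) :* (p :+ q) := p :* p :+ q :* q) ≈-refl p q ⟩
    p * p + q * q        ≈⟨ +-congʳ {q * q} e ⟩
    q * q + q * q        ≈⟨ +-self (q * q) ⟩
    []                   ∎)
  where
  open ≈-Reasoning
  open Poly-Solver using (solve; _:=_; _:+_; _:*_)
... | inj₁ p+q≈[] = +≈0#⇒≈ p q p+q≈[]
... | inj₂ p+q≈[] = +≈0#⇒≈ p q p+q≈[]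

-- Products of powers of linear polynomials

opaque

  -- The normal form for monic polynomials that split over 𝔽₄: e c is the multiplicity of c as a
  -- root, since signs do not matter in characteristic 2.
  ∏ : (𝔽₄ → ℕ) → Poly
  ∏ e = linear 𝟎 ^ e 𝟎 * linear 𝟏 ^ e 𝟏 * linear α ^ e α * linear α+1 ^ e α+1

  ∏-cong : ∀ {e f} → e ≗ f → ∏ e ≈ ∏ f
  ∏-cong {e} {f} e≗f = *-cong (*-cong (*-cong (power 𝟎) (power 𝟏)) (power α)) (power α+1)
    where
    power : ∀ c → linear c ^ e c ≈ linear c ^ f c
    power c = ^-congʳ (linear c) (e≗f c)

  ∏-+ : ∀ e f → ∏ (λ c → e c ℕ.+ f c) ≈ ∏ e * ∏ f
  ∏-+ e f = begin
    ∏ (λ c → e c ℕ.+ f c)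
      ≈⟨ *-cong (*-cong (*-cong (power 𝟎) (power 𝟏)) (power α)) (power α+1) ⟩
    (E 𝟎 * F 𝟎) * (E 𝟏 * F 𝟏) * (E α * F α) * (E α+1 * F α+1)
      ≈⟨ solve 8 (λ p p′ q q′ r r′ s s′ →
           (p :* p′) :* (q :* q′) :* (r :* r′) :* (s :* s′) := (p :* q :* r :* s) :* (p′ :* q′ :* r′ :* s′))
           ≈-refl (E 𝟎) (F 𝟎) (E 𝟏) (F 𝟏) (E α) (F α) (E α+1) (F α+1) ⟩
    ∏ e * ∏ f
      ∎
    where
    open ≈-Reasoning
    open Poly-Solver using (solve; _:=_; _:*_)
    E F : 𝔽₄ → Poly
    E c = linear c ^ e c
    F c = linear c ^ f c
    power : ∀ c → linear c ^ (e c ℕ.+ f c) ≈ E c * F c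
    power c = ^-homo-* (linear c) (e c) (f c)

  ∏-zero : ∏ (λ _ → 0) ≈ 1#
  ∏-zero = solve 0 (con 𝟏 :* con 𝟏 :* con 𝟏 :* con 𝟏 := con 𝟏) ≈-refl
    where open Poly-Solver using (solve; _:=_; _:*_; con)

single : 𝔽₄ → ℕ → 𝔽₄ → ℕ
single c n d = if does (c ≟ d) then n else 0

single-≡ : ∀ c n → single c n c ≡ n
single-≡ c n = cong (λ b → if b then n else 0) (dec-true (c ≟ c) refl)

single-≢ : ∀ {c d} n → c ≢ d → single c n d ≡ 0
single-≢ {c} {d} n c≢d = cong (λ b → if b then n else 0) (dec-false (c ≟ d) c≢d)

opaque
  unfolding ∏

  ∏-single : ∀ c n → ∏ (single c n) ≈ linear c ^ n
  ∏-single 𝟎 n = solve 1 (λ p → p :* con 𝟏 :* con 𝟏 :* con 𝟏 := p) ≈-refl (linear 𝟎 ^ n)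
    where open Poly-Solver using (solve; _:=_; _:*_; con)
  ∏-single 𝟏 n = solve 1 (λ p → con 𝟏 :* p :* con 𝟏 :* con 𝟏 := p) ≈-refl (linear 𝟏 ^ n)
    where open Poly-Solver using (solve; _:=_; _:*_; con)
  ∏-single α n = solve 1 (λ p → con 𝟏 :* con 𝟏 :* p :* con 𝟏 := p) ≈-refl (linear α ^ n)
    where open Poly-Solver using (solve; _:=_; _:*_; con)
  ∏-single α+1 n = solve 1 (λ p → con 𝟏 :* con 𝟏 :* con 𝟏 :* p := p) ≈-refl (linear α+1 ^ n)
    where open Poly-Solver using (solve; _:=_; _:*_; con)

-- A sum of two `single`s rather than a case distinction, so that `∏-pair` is an instance of
-- additivity and holds even when p and q coincide.
pair : 𝔽₄ → 𝔽₄ → ℕ → ℕ → 𝔽₄ → ℕ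
pair p q i j c = single p i c ℕ.+ single q j c

∏-pair : ∀ p q i j → ∏ (pair p q i j) ≈ linear p ^ i * linear q ^ j
∏-pair p q i j = ≈-trans (∏-+ (single p i) (single q j)) (*-cong (∏-single p i) (∏-single q j))

pair-unique : ∀ {p q} e → p ≢ q → (∀ c → c ≢ p → c ≢ q → e c ≡ 0) → e ≗ pair p q (e p) (e q)
pair-unique {p} {q} e p≢q e-zero c with c ≟ p | c ≟ q
... | yes refl | yes refl = contradiction refl p≢q
... | yes refl | no _ = sym (trans (cong₂ ℕ._+_ (single-≡ p (e p)) (single-≢ (e q) (p≢q ∘ sym))) (ℕₚ.+-identityʳ (e p)))
... | no _ | yes refl = sym (cong₂ ℕ._+_ (single-≢ (e p) p≢q) (single-≡ q (e q)))
... | no c≢p | no c≢q = trans (e-zero c c≢p c≢q)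
  (sym (cong₂ ℕ._+_ (single-≢ (e p) (c≢p ∘ sym)) (single-≢ (e q) (c≢q ∘ sym))))

∏-supported-on-pair : ∀ {p q} e → p ≢ q → (∀ c → c ≢ p → c ≢ q → e c ≡ 0) →
                      ∏ e ≈ linear p ^ e p * linear q ^ e q
∏-supported-on-pair {p} {q} e p≢q e-zero =
  ≈-trans (∏-cong (pair-unique e p≢q e-zero)) (∏-pair p q (e p) (e q))

degree : (𝔽₄ → ℕ) → ℕ
degree e = e 𝟎 ℕ.+ e 𝟏 ℕ.+ e α ℕ.+ e α+1

opaque
  unfolding ∏

  HasDegree-∏ : ∀ e → HasDegree (∏ e) (degree e) 𝟏
  HasDegree-∏ e = HasDegree-* (HasDegree-* (HasDegree-* (power 𝟎) (power 𝟏)) (power α)) (power α+1)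
    where
    power : ∀ c → HasDegree (linear c ^ e c) (e c) 𝟏
    power c = HasDegree-linear^ c (e c)

∏-monic : ∀ e → Monic (∏ e)
∏-monic e = HasDegree⇒monic (HasDegree-∏ e)

-- Valuations at linear polynomials

record HasValuation (c : 𝔽₄) (p : Poly) (n : ℕ) : Set where
  constructor hasValuation
  field
    {cofactor} : Poly
    factorizes : p ≈ linear c ^ n * cofactor
    nonroot    : eval c cofactor ≢ 𝟎

HasValuation-cong : ∀ {c p q n} → p ≈ q → HasValuation c p n → HasValuation c q n
HasValuation-cong e (hasValuation f nr) = hasValuation (≈-trans (≈-sym e) f) nr

eval-linear^suc : ∀ c n p → eval c (linear c ^ suc n * p) ≡ 𝟎
eval-linear^suc c n p = begin
  eval c (linear c ^ suc n * p)                                  ≡⟨ eval-* c (linear c ^ suc n) p ⟩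
  eval c (linear c * linear c ^ n) *₄ eval c p                   ≡⟨ cong (_*₄ eval c p) (eval-* c (linear c) (linear c ^ n)) ⟩
  (eval c (linear c) *₄ eval c (linear c ^ n)) *₄ eval c p       ≡⟨ cong (λ u → (u *₄ eval c (linear c ^ n)) *₄ eval c p) (eval-linear-self c) ⟩
  𝟎                                                              ∎
  where open ≡-Reasoning

-- Common factors `linear c` are cancelled until one exponent is exhausted; if the other were not, c
-- would be a root of a cofactor.
HasValuation-unique : ∀ {c p m n} → HasValuation c p m → HasValuation c p n → m ≡ n
HasValuation-unique {c} (hasValuation f nr) (hasValuation g nr′) = go _ _ (≈-trans (≈-sym f) g) nr nr′
  where
  no-root : ∀ n {q r} → linear c ^ suc n * q ≈ linear c ^ 0 * r → eval c r ≡ 𝟎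
  no-root n {q} {r} e = begin
    eval c r                      ≡⟨ eval-cong c (*-identityˡ r) ⟨
    eval c (1# * r)               ≡⟨ eval-cong c e ⟨
    eval c (linear c ^ suc n * q) ≡⟨ eval-linear^suc c n q ⟩
    𝟎                             ∎
    where open ≡-Reasoning
  go : ∀ m n {q r} → linear c ^ m * q ≈ linear c ^ n * r → eval c q ≢ 𝟎 → eval c r ≢ 𝟎 → m ≡ n
  go zero    zero    e nr nr′ = refl
  go zero    (suc n) e nr nr′ = contradiction (no-root n (≈-sym e)) nr
  go (suc m) zero    e nr nr′ = contradiction (no-root m e) nr′
  go (suc m) (suc n) {q} {r} e nr nr′ = cong suc (go m n (*-cancelˡ-linear c (linear c ^ m * q) (linear c ^ n * r) (begin
    linear c * (linear c ^ m * q)   ≈⟨ *-assoc (linear c) (linear c ^ m) q ⟨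
    linear c ^ suc m * q            ≈⟨ e ⟩
    linear c ^ suc n * r            ≈⟨ *-assoc (linear c) (linear c ^ n) r ⟩
    linear c * (linear c ^ n * r)   ∎)) nr nr′)
    where open ≈-Reasoning

HasValuation-* : ∀ {c p q m n} → HasValuation c p m → HasValuation c q n → HasValuation c (p * q) (m ℕ.+ n)
HasValuation-* {c} {p} {q} {m} {n} (hasValuation {p′} f nr) (hasValuation {q′} g nr′) = hasValuation (begin
    p * q                                            ≈⟨ *-cong f g ⟩
    (linear c ^ m * p′) * (linear c ^ n * q′)        ≈⟨ solve 4 (λ a b c d → (a :* b) :* (c :* d) := (a :* c) :* (b :* d)) ≈-refl (linear c ^ m) p′ (linear c ^ n) q′ ⟩
    (linear c ^ m * linear c ^ n) * (p′ * q′)        ≈⟨ *-congʳ {p′ * q′} (^-homo-* (linear c) m n) ⟨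
    linear c ^ (m ℕ.+ n) * (p′ * q′)                 ∎)
  (λ e → *₄-nonzero nr nr′ (trans (sym (eval-* c p′ q′)) e))
  where
  open ≈-Reasoning
  open Poly-Solver using (solve; _:=_; _:*_)

HasValuation-0 : ∀ {c p} → eval c p ≢ 𝟎 → HasValuation c p 0
HasValuation-0 {p = p} = hasValuation (≈-sym (*-identityˡ p))

eval-C : ∀ c u → eval c (C u) ≡ u
eval-C = from-yes (∀? λ c → ∀? λ u → eval c (C u) ≟ u)

eval-^-nonzero : ∀ {c p} n → eval c p ≢ 𝟎 → eval c (p ^ n) ≢ 𝟎
eval-^-nonzero {c}     zero    nz e = contradiction (trans (sym e) (eval-1# c)) λ ()
eval-^-nonzero {c} {p} (suc n) nz e = *₄-nonzero nz (eval-^-nonzero n nz) (trans (sym (eval-* c p (p ^ n))) e)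

HasValuation-linear^ : ∀ c d n → HasValuation c (linear d ^ n) (single d n c)
HasValuation-linear^ c d n with d ≟ c
... | yes refl = subst (HasValuation c (linear c ^ n)) (sym (single-≡ c n))
  (hasValuation (≈-sym (*-identityʳ _)) (λ e → contradiction (trans (sym e) (eval-1# c)) λ ()))
... | no d≢c = subst (HasValuation c (linear d ^ n)) (sym (single-≢ n d≢c))
  (HasValuation-0 (eval-^-nonzero n λ e → d≢c (sym (+₄≡𝟎⇒≡ c d (trans (sym (eval-linear c d)) e)))))

-- The valuation of `∏ e` at c is a sum of four contributions, of which only the one from `linear c`
-- survives.
single-degree : ∀ (e : 𝔽₄ → ℕ) c → degree (λ d → single d (e d) c) ≡ e c
single-degree e 𝟎   = trans (ℕₚ.+-identityʳ _) (trans (ℕₚ.+-identityʳ _) (ℕₚ.+-identityʳ _))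
single-degree e 𝟏   = trans (ℕₚ.+-identityʳ _) (ℕₚ.+-identityʳ _)
single-degree e α   = ℕₚ.+-identityʳ _
single-degree e α+1 = refl

opaque
  unfolding ∏

  HasValuation-∏ : ∀ c e → HasValuation c (∏ e) (e c)
  HasValuation-∏ c e = subst (HasValuation c (∏ e)) (single-degree e c)
    (HasValuation-* (HasValuation-* (HasValuation-* (power 𝟎) (power 𝟏)) (power α)) (power α+1))
    where
    power : ∀ d → HasValuation c (linear d ^ e d) (single d (e d) c)
    power d = HasValuation-linear^ c d (e d)

HasValuation-C* : ∀ {c u p n} → u ≢ 𝟎 → HasValuation c p n → HasValuation c (C u * p) n
HasValuation-C* {c} {u} u≢𝟎 = HasValuation-* (HasValuation-0 {p = C u} (u≢𝟎 ∘ trans (sym (eval-C c u))))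

-- Each exponent is recovered as a valuation, and nonzero scalars do not change valuations.
∏-injective : ∀ {u v e f} → u ≢ 𝟎 → v ≢ 𝟎 → C u * ∏ e ≈ C v * ∏ f → e ≗ f
∏-injective {e = e} {f} u≢𝟎 v≢𝟎 eq c = HasValuation-unique
  (HasValuation-cong eq (HasValuation-C* u≢𝟎 (HasValuation-∏ c e))) (HasValuation-C* v≢𝟎 (HasValuation-∏ c f))

-- Divisors of products of powers of linear polynomials

-- As 𝔽₄ has no zero divisors, c is a root of q or of d. One `linear c` is split off that factor and
-- cancelled on both sides, which lowers n.
factor-linear^ : ∀ c n q d r → q * d ≈ linear c ^ n * r →
  ∃₂ λ i j → ∃₂ λ q′ d′ → i ℕ.+ j ≡ n × q ≈ linear c ^ i * q′ × d ≈ linear c ^ j * d′ × q′ * d′ ≈ r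
factor-linear^ c zero q d r eq =
  0 , 0 , q , d , refl , ≈-sym (*-identityˡ q) , ≈-sym (*-identityˡ d) , ≈-trans eq (*-identityˡ r)
factor-linear^ c (suc n) q d r eq
  with *₄≡𝟎 (eval c q) (eval c d) (trans (sym (eval-* c q d)) (trans (eval-cong c eq) (eval-linear^suc c n r)))
... | inj₁ root = case factor-linear^ c n (quotient c q) d r (*-cancelˡ-linear c (quotient c q * d) (linear c ^ n * r) (begin
    linear c * (quotient c q * d)    ≈⟨ *-assoc (linear c) (quotient c q) d ⟨
    linear c * quotient c q * d      ≈⟨ *-congʳ {d} (factor-theorem c q root) ⟨
    q * d                            ≈⟨ eq ⟩
    linear c ^ suc n * r             ≈⟨ *-assoc (linear c) (linear c ^ n) r ⟩
    linear c * (linear c ^ n * r)    ∎)) of λ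
  { (i , j , q′ , d′ , i+j≡n , q≈ , d≈ , q′d′≈r) →
    suc i , j , q′ , d′ , cong suc i+j≡n
    , ≈-trans (factor-theorem c q root) (≈-trans (*-congˡ {linear c} q≈) (≈-sym (*-assoc (linear c) (linear c ^ i) q′)))
    , d≈ , q′d′≈r }
  where open ≈-Reasoning
... | inj₂ root = case factor-linear^ c n q (quotient c d) r (*-cancelˡ-linear c (q * quotient c d) (linear c ^ n * r) (begin
    linear c * (q * quotient c d)    ≈⟨ solve 3 (λ l q d → l :* (q :* d) := q :* (l :* d)) ≈-refl (linear c) q (quotient c d) ⟩
    q * (linear c * quotient c d)    ≈⟨ *-congˡ {q} (factor-theorem c d root) ⟨
    q * d                            ≈⟨ eq ⟩
    linear c ^ suc n * r             ≈⟨ *-assoc (linear c) (linear c ^ n) r ⟩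
    linear c * (linear c ^ n * r)    ∎)) of λ
  { (i , j , q′ , d′ , i+j≡n , q≈ , d≈ , q′d′≈r) →
    i , suc j , q′ , d′ , trans (ℕₚ.+-suc i j) (cong suc i+j≡n)
    , q≈ , ≈-trans (factor-theorem c d root) (≈-trans (*-congˡ {linear c} d≈) (≈-sym (*-assoc (linear c) (linear c ^ j) d′)))
    , q′d′≈r }
  where
  open ≈-Reasoning
  open Poly-Solver using (solve; _:=_; _:*_)

*≈1# : ∀ q d → q * d ≈ 1# → ∃₂ λ u v → u *₄ v ≡ 𝟏 × q ≈ C u × d ≈ C v
*≈1# q d eq with degree? q | degree? d
... | inj₁ q≈[] | _ = contradiction (≈-trans (≈-sym eq) (*-congʳ-zero q≈[] d)) (HasDegree⇒≉0# (HasDegree-C λ ()))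
... | inj₂ _ | inj₁ d≈[] = contradiction (≈-trans (≈-sym eq) (≈-trans (*-congˡ {q} d≈[]) (*-zeroʳ q))) (HasDegree⇒≉0# (HasDegree-C λ ()))
... | inj₂ (n , u , degq) | inj₂ (m , v , degd)
  with HasDegree-unique (HasDegree-cong eq (HasDegree-* degq degd)) (HasDegree-C λ ())
... | n+m≡0 , uv≡𝟏 = u , v , uv≡𝟏
  , HasDegree-zero (subst (λ n → HasDegree q n u) (ℕₚ.m+n≡0⇒m≡0 n n+m≡0) degq)
  , HasDegree-zero (subst (λ m → HasDegree d m v) (ℕₚ.m+n≡0⇒n≡0 n n+m≡0) degd)

-- `Coprime` quantifies over all common divisors, monic or not, so both factors carry a scalar;
-- `uv≡𝟏` makes the scalars units.
record Factorization (q d : Poly) (e : 𝔽₄ → ℕ) : Set where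
  field
    {u v}  : 𝔽₄
    f g    : 𝔽₄ → ℕ
    uv≡𝟏   : u *₄ v ≡ 𝟏
    q≈     : q ≈ C u * ∏ f
    d≈     : d ≈ C v * ∏ g
    f+g≗e  : ∀ c → f c ℕ.+ g c ≡ e c

  u≢𝟎 : u ≢ 𝟎
  u≢𝟎 u≡𝟎 = contradiction (trans (sym (cong (_*₄ v) u≡𝟎)) uv≡𝟏) λ ()

  v≢𝟎 : v ≢ 𝟎
  v≢𝟎 v≡𝟎 = contradiction (trans (sym (trans (cong (u *₄_) v≡𝟎) (*₄-zeroʳ u))) uv≡𝟏) λ ()

-- Serves in both directions of `factorization`: with t = 1 it nests the product so that one linear
-- factor at a time is exposed, and with t a scalar it reassembles the pieces.
∏-nested : ∀ p q r s t → p * (q * (r * (s * t))) ≈ t * (p * q * r * s)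
∏-nested = solve 5 (λ p q r s t → p :* (q :* (r :* (s :* t))) := t :* (p :* q :* r :* s)) ≈-refl
  where open Poly-Solver using (solve; _:=_; _:*_)

opaque
  unfolding ∏

  -- The powers of the four linear polynomials are distributed in turn by `factor-linear^`. The two
  -- remainders multiply to 1, so they are constants.
  factorization : ∀ q d e → q * d ≈ ∏ e → Factorization q d e
  factorization q d e eq
    with i₀ , j₀ , q₀ , d₀ , n₀ , q≈₀ , d≈₀ , r₀ ← factor-linear^ 𝟎 (e 𝟎) q d _
           (≈-trans eq (≈-trans (≈-sym (*-identityˡ (∏ e)))
           (≈-sym (∏-nested (linear 𝟎 ^ e 𝟎) (linear 𝟏 ^ e 𝟏) (linear α ^ e α) (linear α+1 ^ e α+1) 1#))))
    with i₁ , j₁ , q₁ , d₁ , n₁ , q≈₁ , d≈₁ , r₁ ← factor-linear^ 𝟏 (e 𝟏) q₀ d₀ _ r₀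
    with i₂ , j₂ , q₂ , d₂ , n₂ , q≈₂ , d≈₂ , r₂ ← factor-linear^ α (e α) q₁ d₁ _ r₁
    with i₃ , j₃ , q₃ , d₃ , n₃ , q≈₃ , d≈₃ , r₃ ← factor-linear^ α+1 (e α+1) q₂ d₂ _ r₂
    with u , v , uv≡𝟏 , q≈₄ , d≈₄ ← *≈1# q₃ d₃ r₃
    = record
    { f = λ { 𝟎 → i₀ ; 𝟏 → i₁ ; α → i₂ ; α+1 → i₃ }
    ; g = λ { 𝟎 → j₀ ; 𝟏 → j₁ ; α → j₂ ; α+1 → j₃ }
    ; uv≡𝟏  = uv≡𝟏
    ; q≈    = assemble (linear 𝟎 ^ i₀) (linear 𝟏 ^ i₁) (linear α ^ i₂) (linear α+1 ^ i₃) q≈₀ q≈₁ q≈₂ q≈₃ q≈₄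
    ; d≈    = assemble (linear 𝟎 ^ j₀) (linear 𝟏 ^ j₁) (linear α ^ j₂) (linear α+1 ^ j₃) d≈₀ d≈₁ d≈₂ d≈₃ d≈₄
    ; f+g≗e = λ { 𝟎 → n₀ ; 𝟏 → n₁ ; α → n₂ ; α+1 → n₃ }
    }
    where
    assemble : ∀ {p₀ p₁ p₂ p₃ p₄ t} a b c d → p₀ ≈ a * p₁ → p₁ ≈ b * p₂ → p₂ ≈ c * p₃ → p₃ ≈ d * p₄ → p₄ ≈ t →
               p₀ ≈ t * (a * b * c * d)
    assemble {t = t} a b c d e₀ e₁ e₂ e₃ e₄ = ≈-trans
      (≈-trans e₀ (*-congˡ {a} (≈-trans e₁ (*-congˡ {b} (≈-trans e₂ (*-congˡ {c} (≈-trans e₃ (*-congˡ {d} e₄))))))))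
      (∏-nested a b c d t)

-- For monic d the scalars in the factorization are 1.
record MonicFactorization (q d : Poly) (e : 𝔽₄ → ℕ) : Set where
  field
    f g    : 𝔽₄ → ℕ
    q≈     : q ≈ ∏ f
    d≈     : d ≈ ∏ g
    f+g≗e  : ∀ c → f c ℕ.+ g c ≡ e c

HasDegree-C* : ∀ {u p n v} → u ≢ 𝟎 → HasDegree p n v → HasDegree (C u * p) n (u *₄ v)
HasDegree-C* u≢𝟎 = HasDegree-* (HasDegree-C u≢𝟎)

monic-factorization : ∀ q d e → Monic d → q * d ≈ ∏ e → MonicFactorization q d e
monic-factorization q d e mon eq = record
  { f = f ; g = g ; f+g≗e = f+g≗e
  ; q≈ = unscale u≡𝟏 q≈
  ; d≈ = unscale v≡𝟏 d≈
  }
  where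
  open Factorization (factorization q d e eq)
  unscale : ∀ {w p r} → w ≡ 𝟏 → p ≈ C w * r → p ≈ r
  unscale {r = r} refl p≈ = ≈-trans p≈ (*-identityˡ r)
  v≡𝟏 : v ≡ 𝟏
  v≡𝟏 = trans (sym (*₄-identityʳ v)) (proj₂ (HasDegree-unique
    (HasDegree-cong (≈-sym d≈) (HasDegree-C* v≢𝟎 (HasDegree-∏ g))) (proj₂ (monic⇒HasDegree mon))))
  u≡𝟏 : u ≡ 𝟏
  u≡𝟏 = trans (sym (*₄-identityʳ u)) (trans (cong (u *₄_) (sym v≡𝟏)) uv≡𝟏)

∣∏ : ∀ {z e} → z ∣ ∏ e → ∃₂ λ v g → v ≢ 𝟎 × z ≈ C v * ∏ g × (∀ c → g c ≤ e c)
∣∏ {z} {e} (q , eq) = v , g , v≢𝟎 , d≈ , λ c → ℕₚ.m+n≤o⇒n≤o (f c) (ℕₚ.≤-reflexive (f+g≗e c))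
  where open Factorization (factorization q z e eq)

C*∏≈C : ∀ {u e} → (∀ c → e c ≡ 0) → C u * ∏ e ≈ C u
C*∏≈C {u} {e} e≗0 = ≈-trans (*-congˡ {C u} (≈-trans (∏-cong e≗0) ∏-zero)) (*-identityʳ (C u))

C∣1# : ∀ {u} → u ≢ 𝟎 → C u ∣ 1#
C∣1# {u} u≢𝟎 = C (inverse u) , ∷-cong (trans (+₄-identityʳ _) (*₄-inverseˡ u u≢𝟎)) ≈-refl

-- A common divisor is a scalar times some `∏ g` and, by injectivity, has the same exponents whether
-- it is seen below e or below f. At every point one of these bounds is 0, so the divisor is a unit.
∏-coprime : ∀ {e f} → (∀ c → e c ≡ 0 ⊎ f c ≡ 0) → Coprime (∏ e) (∏ f)
∏-coprime {e} {f} disjoint {z} z∣e z∣f with ∣∏ {z} {e} z∣e | ∣∏ {z} {f} z∣f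
... | u , g , u≢𝟎 , z≈ , g≤e | v , h , v≢𝟎 , z≈′ , h≤f =
  ∣-respˡ (≈-sym (≈-trans z≈ (C*∏≈C g≗0))) (C∣1# u≢𝟎)
  where
  g≗h : g ≗ h
  g≗h = ∏-injective u≢𝟎 v≢𝟎 (≈-trans (≈-sym z≈) z≈′)
  g≗0 : ∀ c → g c ≡ 0
  g≗0 c with disjoint c
  ... | inj₁ e≡0 = ℕₚ.n≤0⇒n≡0 (subst (g c ≤_) e≡0 (g≤e c))
  ... | inj₂ f≡0 = ℕₚ.n≤0⇒n≡0 (subst (_≤ 0) (sym (g≗h c)) (subst (h c ≤_) f≡0 (h≤f c)))

linear∤1# : ∀ c → ¬ linear c ∣ 1#
linear∤1# c (q , eq) = contradiction (begin
  𝟎                                  ≡⟨ *₄-zeroʳ (eval c q) ⟨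
  eval c q *₄ 𝟎                      ≡⟨ cong (eval c q *₄_) (eval-linear-self c) ⟨
  eval c q *₄ eval c (linear c)      ≡⟨ eval-* c q (linear c) ⟨
  eval c (q * linear c)              ≡⟨ eval-cong c eq ⟩
  eval c 1#                          ≡⟨ eval-1# c ⟩
  𝟏                                  ∎) λ ()
  where open ≡-Reasoning

linear∣∏ : ∀ c e → e c ≢ 0 → linear c ∣ ∏ e
linear∣∏ c e ec≢0 with e c | HasValuation-∏ c e
... | zero  | _ = contradiction refl ec≢0
... | suc n | hasValuation {r} eq _ = linear c ^ n * r , ≈-sym (≈-trans eq
  (solve 3 (λ l p r → (l :* p) :* r := (p :* r) :* l) ≈-refl (linear c) (linear c ^ n) r))
  where open Poly-Solver using (solve; _:=_; _:*_)

∏-coprime⁻ : ∀ {e f} → Coprime (∏ e) (∏ f) → ∀ c → e c ≡ 0 ⊎ f c ≡ 0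
∏-coprime⁻ {e} {f} cop c with e c ℕₚ.≟ 0 | f c ℕₚ.≟ 0
... | yes e≡0 | _ = inj₁ e≡0
... | no _ | yes f≡0 = inj₂ f≡0
... | no e≢0 | no f≢0 = contradiction (cop (linear∣∏ c e e≢0) (linear∣∏ c f f≢0)) (linear∤1# c)

Coprime-resp : ∀ {p p′ q q′} → p ≈ p′ → q ≈ q′ → Coprime p q → Coprime p′ q′
Coprime-resp p≈p′ q≈q′ cop z∣p′ z∣q′ = cop (∣-respʳ (≈-sym p≈p′) z∣p′) (∣-respʳ (≈-sym q≈q′) z∣q′)

-- Unitary and bi-unitary divisors

Monic-cong : ∀ {p q} → p ≈ q → Monic p → Monic q
Monic-cong p≈q mon = HasDegree⇒monic (HasDegree-cong p≈q (proj₂ (monic⇒HasDegree mon)))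

∏-∸ : ∀ {e f} → (∀ c → f c ≤ e c) → ∏ (λ c → e c ∸ f c) * ∏ f ≈ ∏ e
∏-∸ {e} {f} f≤e = ≈-trans (≈-sym (∏-+ (λ c → e c ∸ f c) f)) (∏-cong λ c → ℕₚ.m∸n+n≡m (f≤e c))

unitaryDivisor⁺ : ∀ {s d e h} → s ≈ ∏ e → d ≈ ∏ h → (∀ c → h c ≡ 0 ⊎ h c ≡ e c) → UnitaryDivisor s d
unitaryDivisor⁺ {s} {d} {e} {h} s≈ d≈ unitary =
    Monic-cong (≈-sym d≈) (∏-monic h)
  , ∏ (λ c → e c ∸ h c)
  , ≈-trans (*-congˡ {∏ (λ c → e c ∸ h c)} d≈) (≈-trans (∏-∸ h≤e) (≈-sym s≈))
  , λ {z} → Coprime-resp (≈-sym d≈) ≈-refl (∏-coprime disjoint) {z}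
  where
  h≤e : ∀ c → h c ≤ e c
  h≤e c with unitary c
  ... | inj₁ h≡0 = subst (_≤ e c) (sym h≡0) z≤n
  ... | inj₂ h≡e = ℕₚ.≤-reflexive h≡e
  disjoint : ∀ c → h c ≡ 0 ⊎ e c ∸ h c ≡ 0
  disjoint c with unitary c
  ... | inj₁ h≡0 = inj₁ h≡0
  ... | inj₂ h≡e = inj₂ (ℕₚ.m≤n⇒m∸n≡0 (ℕₚ.≤-reflexive (sym h≡e)))

unitaryDivisor⁻ : ∀ {s d e} → s ≈ ∏ e → UnitaryDivisor s d →
                  ∃ λ h → d ≈ ∏ h × (∀ c → h c ≡ 0 ⊎ h c ≡ e c)
unitaryDivisor⁻ {s} {d} {e} s≈ (mon , q , qd≈s , cop) = g , d≈ , unitary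
  where
  open MonicFactorization (monic-factorization q d e mon (≈-trans qd≈s s≈))
  unitary : ∀ c → g c ≡ 0 ⊎ g c ≡ e c
  unitary c with ∏-coprime⁻ (λ {z} → Coprime-resp d≈ q≈ cop {z}) c
  ... | inj₁ g≡0 = inj₁ g≡0
  ... | inj₂ f≡0 = inj₂ (trans (cong (ℕ._+ g c) (sym f≡0)) (f+g≗e c))

-- xⁱ is a bi-unitary divisor of xⁿ iff i ≤ n and BiunitaryExponent n i.
BiunitaryExponent : ℕ → ℕ → Set
BiunitaryExponent n i = i ≡ 0 ⊎ i ℕ.+ i ≢ n

biunitaryExponent? : ∀ n → Decidable (BiunitaryExponent n)
biunitaryExponent? n i = (i ℕₚ.≟ 0) ⊎-dec ¬? (i ℕ.+ i ℕₚ.≟ n)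

-- Where a common unitary divisor of d and its cofactor has a nonzero exponent, that exponent is the
-- full one on both sides, so `g c` equals `e c ∸ g c`; this is what `BiunitaryExponent` rules out.
biunitaryDivisor⁺ : ∀ {s d e g} → s ≈ ∏ e → d ≈ ∏ g → (∀ c → g c ≤ e c × BiunitaryExponent (e c) (g c)) →
                    BiunitaryDivisor s d
biunitaryDivisor⁺ {s} {d} {e} {g} s≈ d≈ biunitary =
    Monic-cong (≈-sym d≈) (∏-monic g)
  , ∏ f
  , ≈-trans (*-congˡ {∏ f} d≈) (≈-trans (∏-∸ (proj₁ ∘ biunitary)) (≈-sym s≈))
  , unitaryDivisor⁺ d≈ (≈-sym ∏-zero) (λ _ → inj₁ refl)
  , unitaryDivisor⁺ {e = f} ≈-refl (≈-sym ∏-zero) (λ _ → inj₁ refl)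
  , greatest
  where
  f : 𝔽₄ → ℕ
  f c = e c ∸ g c
  greatest : ∀ p → UnitaryDivisor d p → UnitaryDivisor (∏ f) p → p ∣ 1#
  greatest p p∥d p∥f with unitaryDivisor⁻ {e = g} d≈ p∥d | unitaryDivisor⁻ {e = f} ≈-refl p∥f
  ... | h , p≈ , unitary | h′ , p≈′ , unitary′ = 1# , ≈-trans (*-identityˡ p) (≈-trans p≈ (≈-trans (∏-cong h≗0) ∏-zero))
    where
    h≗h′ : h ≗ h′
    h≗h′ = ∏-injective {𝟏} {𝟏} (λ ()) (λ ()) (*-congˡ {1#} (≈-trans (≈-sym p≈) p≈′))
    h≗0 : ∀ c → h c ≡ 0
    h≗0 c with unitary c | unitary′ c | proj₂ (biunitary c)
    ... | inj₁ h≡0 | _ | _ = h≡0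
    ... | inj₂ h≡g | _ | inj₁ g≡0 = trans h≡g g≡0
    ... | inj₂ _ | inj₁ h′≡0 | _ = trans (h≗h′ c) h′≡0
    ... | inj₂ h≡g | inj₂ h′≡f | inj₂ g+g≢e = contradiction
      (trans (cong (ℕ._+ g c) (trans (sym h≡g) (trans (h≗h′ c) h′≡f))) (ℕₚ.m∸n+n≡m (proj₁ (biunitary c)))) g+g≢e

linear^∣1#⇒≡0 : ∀ c n → linear c ^ n ∣ 1# → n ≡ 0
linear^∣1#⇒≡0 c zero    _        = refl
linear^∣1#⇒≡0 c (suc n) (q , eq) = contradiction (q * linear c ^ n , ≈-trans
  (solve 3 (λ q l p → q :* p :* l := q :* (l :* p)) ≈-refl q (linear c) (linear c ^ n)) eq) (linear∤1# c)
  where open Poly-Solver using (solve; _:=_; _:*_)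

-- If the exponents of linear c in d and in its cofactor are equal, then that power of linear c is a
-- common unitary divisor of both.
biunitaryDivisor⁻ : ∀ {s d e} → s ≈ ∏ e → BiunitaryDivisor s d →
                    ∃ λ g → d ≈ ∏ g × (∀ c → g c ≤ e c × BiunitaryExponent (e c) (g c))
biunitaryDivisor⁻ {s} {d} {e} s≈ (mon , q , qd≈s , _ , _ , greatest) = g , d≈ , biunitary
  where
  open MonicFactorization (monic-factorization q d e mon (≈-trans qd≈s s≈))
  single-unitary : ∀ c n h → n ≡ h c → ∀ d → single c n d ≡ 0 ⊎ single c n d ≡ h d
  single-unitary c n h n≡hc d with c ≟ d
  ... | yes refl = inj₂ (trans (single-≡ c n) n≡hc)
  ... | no c≢d   = inj₁ (single-≢ n c≢d)
  biunitary : ∀ c → g c ≤ e c × BiunitaryExponent (e c) (g c)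
  biunitary c = ℕₚ.m+n≤o⇒n≤o (f c) (ℕₚ.≤-reflexive (f+g≗e c)) , exponent
    where
    exponent : BiunitaryExponent (e c) (g c)
    exponent with g c ℕ.+ g c ℕₚ.≟ e c
    ... | no  g+g≢e = inj₂ g+g≢e
    ... | yes g+g≡e = inj₁ (linear^∣1#⇒≡0 c (g c) (greatest (linear c ^ g c)
      (unitaryDivisor⁺ d≈ power≈ (single-unitary c (g c) g refl))
      (unitaryDivisor⁺ q≈ power≈ (single-unitary c (g c) f
        (ℕₚ.+-cancelʳ-≡ (g c) (g c) (f c) (trans g+g≡e (sym (f+g≗e c))))))))
      where
      power≈ : linear c ^ g c ≈ ∏ (single c (g c))
      power≈ = ≈-sym (∏-single c (g c))

-- Sums over enumerations

∑ : List Poly → Poly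
∑ = foldr _+_ 0#

∈⇒↭ : ∀ {x ys} → x ∈ ys → ∃ λ zs → ys ↭ x ∷ zs
∈⇒↭ {ys = y ∷ ys} (here x≈y) = ys , ↭.prep (≈-sym x≈y) ↭.↭-refl
∈⇒↭ {x} {y ∷ ys} (there x∈ys) with ∈⇒↭ x∈ys
... | zs , ys↭ = y ∷ zs , ↭.↭-trans (↭.↭-prep y ys↭) (↭.↭-swap y x ↭.↭-refl)

-- The head of `xs` is moved to the front of `ys`. Neither tail contains it, as both lists are free
-- of repetitions, so the tails again have the same elements.
unique∧set⇒↭ : ∀ {xs ys} → Unique xs → Unique ys → (∀ z → z ∈ xs ⇔ z ∈ ys) → xs ↭ ys
unique∧set⇒↭ {[]} {[]} _ _ _ = ↭.↭-refl
unique∧set⇒↭ {[]} {y ∷ ys} _ _ set with () ← from (set y) (here ≈-refl)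
unique∧set⇒↭ {x ∷ xs} {ys} xs! ys! set with ∈⇒↭ (to (set x) (here ≈-refl))
... | zs , ys↭ = ↭.↭-trans (↭.↭-prep x (unique∧set⇒↭ (tail xs!) (tail x∷zs!)
    λ z → mk⇔ (forward z) (backward z))) (↭.↭-sym ys↭)
  where
  x∷zs! : Unique (x ∷ zs)
  x∷zs! = Unique-resp-↭ ys↭ ys!
  forward : ∀ z → z ∈ xs → z ∈ zs
  forward z z∈xs with ∈-resp-↭ ys↭ (to (set z) (there z∈xs))
  ... | here z≈x = contradiction (∈-resp-≈ ≈-setoid z≈x z∈xs) (Unique[x∷xs]⇒x∉xs ≈-setoid xs!)
  ... | there z∈zs = z∈zs
  backward : ∀ z → z ∈ zs → z ∈ xs
  backward z z∈zs with from (set z) (∈-resp-↭ (↭.↭-sym ys↭) (there z∈zs))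
  ... | here z≈x = contradiction (∈-resp-≈ ≈-setoid z≈x z∈zs) (Unique[x∷xs]⇒x∉xs ≈-setoid x∷zs!)
  ... | there z∈xs = z∈xs

-- Makes σ** single-valued: the unknown listing inside `σ**[_]=_` can be exchanged for a convenient
-- one.
∑-enumerates : ∀ {xs ys P} → Enumerates xs P → Enumerates ys P → ∑ xs ≈ ∑ ys
∑-enumerates (xs! , ∈xs⇔) (ys! , ∈ys⇔) = foldr-commMonoid
  (CommutativeMonoid.isCommutativeMonoid +-commutativeMonoid)
  (unique∧set⇒↭ xs! ys! λ z → mk⇔ (from (∈ys⇔ z) ∘ to (∈xs⇔ z)) (from (∈xs⇔ z) ∘ to (∈ys⇔ z)))

∑-++ : ∀ xs ys → ∑ (xs ++ ys) ≈ ∑ xs + ∑ ys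
∑-++ []       ys = ≈-refl
∑-++ (x ∷ xs) ys = ≈-trans (+-congˡ {x} (∑-++ xs ys)) (≈-sym (+-assoc x (∑ xs) (∑ ys)))

module _ {A : Set} (u v : A → Poly) where

  ∑-map-* : ∀ p ys → ∑ (map (λ y → p * v y) ys) ≈ p * ∑ (map v ys)
  ∑-map-* p []       = ≈-sym (*-zeroʳ p)
  ∑-map-* p (y ∷ ys) = ≈-trans (+-congˡ {p * v y} (∑-map-* p ys)) (≈-sym (distribˡ p (v y) (∑ (map v ys))))

  ∑-cartesianProductWith : ∀ xs ys →
    ∑ (cartesianProductWith (λ x y → u x * v y) xs ys) ≈ ∑ (map u xs) * ∑ (map v ys)
  ∑-cartesianProductWith []       ys = ≈-refl
  ∑-cartesianProductWith (x ∷ xs) ys = begin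
    ∑ (map (λ y → u x * v y) ys ++ products)              ≈⟨ ∑-++ (map (λ y → u x * v y) ys) products ⟩
    ∑ (map (λ y → u x * v y) ys) + ∑ products             ≈⟨ +-cong (∑-map-* (u x) ys) (∑-cartesianProductWith xs ys) ⟩
    u x * ∑ (map v ys) + ∑ (map u xs) * ∑ (map v ys)      ≈⟨ *-distribʳ-+ (∑ (map v ys)) (u x) (∑ (map u xs)) ⟨
    (u x + ∑ (map u xs)) * ∑ (map v ys)                   ∎
    where
    open ≈-Reasoning
    products : List Poly
    products = cartesianProductWith (λ x y → u x * v y) xs ys

-- The values σ**(pᵃqᵇ) for linear p and q

-- In descending order and with n included, so that the top exponent is peeled off first, as in
-- `power-sum` and `geometric-sum`.
exponents : ℕ → List ℕ
exponents n = filter (biunitaryExponent? n) (downFrom (suc n))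

∈-exponents⁺ : ∀ {n i} → i ≤ n → BiunitaryExponent n i → i ∈ₚ exponents n
∈-exponents⁺ {n} i≤n = ∈-filter⁺ (biunitaryExponent? n) (∈-downFrom⁺ (s≤s i≤n))

∈-exponents⁻ : ∀ {n i} → i ∈ₚ exponents n → i ≤ n × BiunitaryExponent n i
∈-exponents⁻ {n} i∈ with ∈-filter⁻ (biunitaryExponent? n) {xs = downFrom (suc n)} i∈
... | i∈′ , biunitary = ℕₚ.≤-pred (∈-downFrom⁻ i∈′) , biunitary

exponents-unique : ∀ n → Uniqueₚ (exponents n)
exponents-unique n = filter⁺ (≡-setoid ℕ) (biunitaryExponent? n) (downFrom⁺ (suc n))

σ** : 𝔽₄ → ℕ → Poly
σ** p n = ∑ (map (linear p ^_) (exponents n))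

module _ {p q : 𝔽₄} (p≢q : p ≢ q) where

  pair-p : ∀ i j → pair p q i j p ≡ i
  pair-p i j = trans (cong₂ ℕ._+_ (single-≡ p i) (single-≢ j (p≢q ∘ sym))) (ℕₚ.+-identityʳ i)

  pair-q : ∀ i j → pair p q i j q ≡ j
  pair-q i j = cong₂ ℕ._+_ (single-≢ i p≢q) (single-≡ q j)

  pair-other : ∀ i j c → c ≢ p → c ≢ q → pair p q i j c ≡ 0
  pair-other i j c c≢p c≢q = cong₂ ℕ._+_ (single-≢ i (c≢p ∘ sym)) (single-≢ j (c≢q ∘ sym))

  power-product : ℕ → ℕ → Poly
  power-product i j = linear p ^ i * linear q ^ j

  power-product-injective : ∀ {i i′ j j′} → power-product i j ≈ power-product i′ j′ → i ≡ i′ × j ≡ j′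
  power-product-injective {i} {i′} {j} {j′} eq =
      trans (sym (pair-p i j)) (trans (same p) (pair-p i′ j′))
    , trans (sym (pair-q i j)) (trans (same q) (pair-q i′ j′))
    where
    same : pair p q i j ≗ pair p q i′ j′
    same = ∏-injective {𝟏} {𝟏} (λ ()) (λ ()) (*-congˡ {1#}
      (≈-trans (∏-pair p q i j) (≈-trans eq (≈-sym (∏-pair p q i′ j′)))))

  -- Bi-unitarity is tested at each exponent separately, so the divisors form a product of two sets
  -- of exponents. This is the source of the multiplicativity of σ**.
  biunitary-divisors : ∀ {s e} → s ≈ ∏ e → (∀ c → c ≢ p → c ≢ q → e c ≡ 0) →
    Enumerates (cartesianProductWith power-product (exponents (e p)) (exponents (e q))) (BiunitaryDivisor s)
  biunitary-divisors {s} {e} s≈ e-zero =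
      cartesianProductWith⁺ (≡-setoid ℕ) (≡-setoid ℕ) ≈-setoid power-product power-product-injective
        (exponents-unique (e p)) (exponents-unique (e q))
    , λ d → mk⇔ (forward d) (backward d)
    where
    products : List Poly
    products = cartesianProductWith power-product (exponents (e p)) (exponents (e q))
    forward : ∀ d → d ∈ products → BiunitaryDivisor s d
    forward d d∈
      with i , j , i∈ , j∈ , d≈ ← ∈-cartesianProductWith⁻ (≡-setoid ℕ) (≡-setoid ℕ) ≈-setoid
             power-product (exponents (e p)) (exponents (e q)) d∈
      = biunitaryDivisor⁺ s≈ (≈-trans d≈ (≈-sym (∏-pair p q i j))) biunitary
      where
      biunitary : ∀ c → pair p q i j c ≤ e c × BiunitaryExponent (e c) (pair p q i j c)
      biunitary c with c ≟ p | c ≟ q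
      ... | yes refl | _ = subst (λ k → k ≤ e p × BiunitaryExponent (e p) k) (sym (pair-p i j)) (∈-exponents⁻ i∈)
      ... | no _ | yes refl = subst (λ k → k ≤ e q × BiunitaryExponent (e q) k) (sym (pair-q i j)) (∈-exponents⁻ j∈)
      ... | no c≢p | no c≢q = subst (λ k → k ≤ e c × BiunitaryExponent (e c) k) (sym (pair-other i j c c≢p c≢q)) (z≤n , inj₁ refl)
    backward : ∀ d → BiunitaryDivisor s d → d ∈ products
    backward d d∣∣s
      with g , d≈ , biunitary ← biunitaryDivisor⁻ {e = e} s≈ d∣∣s
      = ∈-resp-≈ ≈-setoid (≈-sym (≈-trans d≈ (∏-supported-on-pair g p≢q
          λ c c≢p c≢q → ℕₚ.n≤0⇒n≡0 (subst (g c ≤_) (e-zero c c≢p c≢q) (proj₁ (biunitary c))))))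
        (∈-cartesianProductWith⁺ (≡-setoid ℕ) (≡-setoid ℕ) ≈-setoid
          (λ { refl refl → ≈-refl }) (member p) (member q))
      where
      member : ∀ c → g c ∈ₚ exponents (e c)
      member c = ∈-exponents⁺ (proj₁ (biunitary c)) (proj₂ (biunitary c))

  perfect⇒σ**-product : ∀ {s e} → s ≈ ∏ e → (∀ c → c ≢ p → c ≢ q → e c ≡ 0) → BiunitaryPerfect s →
                        σ** p (e p) * σ** q (e q) ≈ ∏ e
  perfect⇒σ**-product {s} {e} s≈ e-zero (_ , L , enum , sum) = begin
    σ** p (e p) * σ** q (e q)
      ≈⟨ ∑-cartesianProductWith (linear p ^_) (linear q ^_) (exponents (e p)) (exponents (e q)) ⟨
    ∑ (cartesianProductWith power-product (exponents (e p)) (exponents (e q)))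
      ≈⟨ ∑-enumerates (biunitary-divisors s≈ e-zero) enum ⟩
    ∑ L
      ≈⟨ sum ⟩
    s
      ≈⟨ s≈ ⟩
    ∏ e
      ∎
    where open ≈-Reasoning

-- The shape of σ**(pᵃ)

parity : ∀ n → ∃ λ k → n ≡ k ℕ.+ k ⊎ n ≡ suc (k ℕ.+ k)
parity zero = 0 , inj₁ refl
parity (suc n) with parity n
... | k , inj₁ refl = k , inj₂ refl
... | k , inj₂ refl = suc k , inj₁ (cong suc (sym (ℕₚ.+-suc k k)))

i+i≢1+k+k : ∀ i k → i ℕ.+ i ≢ suc (k ℕ.+ k)
i+i≢1+k+k (suc i) zero    e = contradiction (trans (sym (ℕₚ.+-suc i i)) (ℕₚ.suc-injective e)) λ ()
i+i≢1+k+k (suc i) (suc k) e = i+i≢1+k+k i k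
  (ℕₚ.suc-injective (trans (sym (ℕₚ.+-suc i i)) (trans (ℕₚ.suc-injective e) (cong suc (ℕₚ.+-suc k k)))))

eval-linear^-suc : ∀ p q n → eval p (linear q ^ suc n) ≡ (p +₄ q) *₄ eval p (linear q ^ n)
eval-linear^-suc p q n = trans (eval-* p (linear q) (linear q ^ n)) (cong (_*₄ eval p (linear q ^ n)) (eval-linear p q))

der-linear^-suc : ∀ p q n →
  der p (linear q ^ suc n) ≡ eval p (linear q ^ n) +₄ (p +₄ q) *₄ der p (linear q ^ n)
der-linear^-suc p q n = trans (der-* p (linear q) (linear q ^ n))
  (cong₂ (λ u v → u *₄ eval p (linear q ^ n) +₄ v *₄ der p (linear q ^ n)) (der-linear p q) (eval-linear p q))

-- After two applications of the product rule the terms with `eval` cancel in characteristic 2.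
-- Hence derivatives vanish at even exponents and, for q = p, from exponent 2 on.
der-linear^-suc-suc : ∀ p q n →
  der p (linear q ^ suc (suc n)) ≡ (p +₄ q) *₄ ((p +₄ q) *₄ der p (linear q ^ n))
der-linear^-suc-suc p q n = begin
  der p (linear q ^ suc (suc n))
    ≡⟨ der-linear^-suc p q (suc n) ⟩
  eval p (linear q ^ suc n) +₄ d *₄ der p (linear q ^ suc n)
    ≡⟨ cong₂ (λ u v → u +₄ d *₄ v) (eval-linear^-suc p q n) (der-linear^-suc p q n) ⟩
  d *₄ eval p (linear q ^ n) +₄ d *₄ (eval p (linear q ^ n) +₄ d *₄ der p (linear q ^ n))
    ≡⟨ solve 3 (λ d u v → d :* u :+ d :* (u :+ d :* v) := d :* (d :* v)) refl d (eval p (linear q ^ n)) (der p (linear q ^ n)) ⟩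
  d *₄ (d *₄ der p (linear q ^ n))
    ∎
  where
  open ≡-Reasoning
  open 𝔽₄-Solver using (solve; _:=_; _:+_; _:*_)
  d : 𝔽₄
  d = p +₄ q

der-1# : ∀ p → der p 1# ≡ 𝟎
der-1# p = *₄-zeroʳ p

der-linear^-even : ∀ p q k → der p (linear q ^ (k ℕ.+ k)) ≡ 𝟎
der-linear^-even p q zero    = der-1# p
der-linear^-even p q (suc k) = begin
  der p (linear q ^ suc (k ℕ.+ suc k))                       ≡⟨ cong (λ n → der p (linear q ^ suc n)) (ℕₚ.+-suc k k) ⟩
  der p (linear q ^ suc (suc (k ℕ.+ k)))                     ≡⟨ der-linear^-suc-suc p q (k ℕ.+ k) ⟩
  d *₄ (d *₄ der p (linear q ^ (k ℕ.+ k)))                   ≡⟨ cong (λ u → d *₄ (d *₄ u)) (der-linear^-even p q k) ⟩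
  d *₄ (d *₄ 𝟎)                                              ≡⟨ cong (d *₄_) (*₄-zeroʳ d) ⟩
  d *₄ 𝟎                                                     ≡⟨ *₄-zeroʳ d ⟩
  𝟎                                                          ∎
  where
  open ≡-Reasoning
  d : 𝔽₄
  d = p +₄ q

der-linear^-odd : ∀ p q k → der p (linear q ^ suc (k ℕ.+ k)) ≡ eval p (linear q ^ (k ℕ.+ k))
der-linear^-odd p q k = begin
  der p (linear q ^ suc (k ℕ.+ k))
    ≡⟨ der-linear^-suc p q (k ℕ.+ k) ⟩
  eval p (linear q ^ (k ℕ.+ k)) +₄ (p +₄ q) *₄ der p (linear q ^ (k ℕ.+ k))
    ≡⟨ cong (λ u → eval p (linear q ^ (k ℕ.+ k)) +₄ (p +₄ q) *₄ u) (der-linear^-even p q k) ⟩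
  eval p (linear q ^ (k ℕ.+ k)) +₄ (p +₄ q) *₄ 𝟎
    ≡⟨ cong (eval p (linear q ^ (k ℕ.+ k)) +₄_) (*₄-zeroʳ (p +₄ q)) ⟩
  eval p (linear q ^ (k ℕ.+ k)) +₄ 𝟎
    ≡⟨ +₄-identityʳ _ ⟩
  eval p (linear q ^ (k ℕ.+ k))
    ∎
  where open ≡-Reasoning

eval-linear^-self : ∀ p n → eval p (linear p ^ suc n) ≡ 𝟎
eval-linear^-self p n = trans (eval-linear^-suc p p n) (cong (_*₄ eval p (linear p ^ n)) (+₄-self p))

der-linear^-self : ∀ p n → der p (linear p ^ suc (suc n)) ≡ 𝟎
der-linear^-self p n = trans (der-linear^-suc-suc p p n) (cong (_*₄ ((p +₄ p) *₄ der p (linear p ^ n))) (+₄-self p))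

module _ (p : 𝔽₄) {P : ℕ → Set} (P? : Decidable P) where

  -- In `exponents n` the number n occurs both in the filter and in the range. Keeping the predicate
  -- fixed and varying only the range makes induction possible.
  power-sum : ℕ → Poly
  power-sum n = ∑ (map (linear p ^_) (filter P? (downFrom n)))

  power-sum-accept : ∀ {n} → P n → power-sum (suc n) ≡ linear p ^ n + power-sum n
  power-sum-accept Pn = cong (∑ ∘ map (linear p ^_)) (filter-accept P? Pn)

  power-sum-reject : ∀ {n} → ¬ P n → power-sum (suc n) ≡ power-sum n
  power-sum-reject ¬Pn = cong (∑ ∘ map (linear p ^_)) (filter-reject P? ¬Pn)

  -- An additive functional that vanishes on the top power does not see whether the filter keeps
  -- that power. It is applied to values, derivatives and single coefficients.
  power-sum-preserves : (F : Poly → 𝔽₄) → (∀ q r → F (q + r) ≡ F q +₄ F r) →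
                        ∀ n → F (linear p ^ n) ≡ 𝟎 → F (power-sum (suc n)) ≡ F (power-sum n)
  power-sum-preserves F F-+ n F≡𝟎 = [ accept , cong F ∘ power-sum-reject ]′ (toSum (P? n))
    where
    accept : P n → F (power-sum (suc n)) ≡ F (power-sum n)
    accept Pn = trans (cong F (power-sum-accept Pn))
      (trans (F-+ (linear p ^ n) (power-sum n)) (cong (_+₄ F (power-sum n)) F≡𝟎))

  eval-power-sum : P 0 → ∀ n → eval p (power-sum (suc n)) ≡ 𝟏
  eval-power-sum P0 zero    = trans (cong (eval p) (power-sum-accept P0)) (eval-1# p)
  eval-power-sum P0 (suc n) = trans
    (power-sum-preserves (eval p) (eval-+ p) (suc n) (eval-linear^-self p n)) (eval-power-sum P0 n)

  der-power-sum : P 0 → P 1 → ∀ n → der p (power-sum (suc (suc n))) ≡ 𝟏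
  der-power-sum P0 P1 zero = begin
    der p (power-sum 2)                            ≡⟨ cong (der p) (power-sum-accept P1) ⟩
    der p (linear p ^ 1 + power-sum 1)             ≡⟨ der-+ p (linear p ^ 1) (power-sum 1) ⟩
    der p (linear p ^ 1) +₄ der p (power-sum 1)    ≡⟨ cong₂ _+₄_ (der-linear^-odd p p 0) (cong (der p) (power-sum-accept P0)) ⟩
    eval p 1# +₄ der p 1#                          ≡⟨ cong₂ _+₄_ (eval-1# p) (der-1# p) ⟩
    𝟏                                              ∎
    where open ≡-Reasoning
  der-power-sum P0 P1 (suc n) = trans
    (power-sum-preserves (der p) (der-+ p) (suc (suc n)) (der-linear^-self p n)) (der-power-sum P0 P1 n)

  coeff-power-sum : ∀ n m → n ≤ m → coeff (power-sum n) m ≡ 𝟎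
  coeff-power-sum zero    m _   = refl
  coeff-power-sum (suc n) m n<m = trans
    (power-sum-preserves (λ q → coeff q m) (λ q r → coeff-+ q r m) n (above (HasDegree-linear^ p n) m n<m))
    (coeff-power-sum n m (ℕₚ.<⇒≤ n<m))

  HasDegree-power-sum : ∀ n → P n → HasDegree (power-sum (suc n)) n 𝟏
  HasDegree-power-sum n Pn = hasDegree
    (trans (cong (λ q → coeff q n) (power-sum-accept Pn)) (trans (coeff-+ (linear p ^ n) (power-sum n) n)
      (cong₂ _+₄_ (leading (HasDegree-linear^ p n)) (coeff-power-sum n n ℕₚ.≤-refl))))
    (λ ()) (coeff-power-sum (suc n))

n-biunitaryExponent : ∀ n → BiunitaryExponent n n
n-biunitaryExponent zero    = inj₁ refl
n-biunitaryExponent (suc n) = inj₂ (ℕₚ.m+1+n≢m (suc n))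

HasDegree-σ** : ∀ p n → HasDegree (σ** p n) n 𝟏
HasDegree-σ** p n = HasDegree-power-sum p (biunitaryExponent? n) n (n-biunitaryExponent n)

eval-σ** : ∀ p n → eval p (σ** p n) ≡ 𝟏
eval-σ** p n = eval-power-sum p (biunitaryExponent? n) (inj₁ refl) n

der-σ** : ∀ p n → der p (σ** p (suc (suc (suc n)))) ≡ 𝟏
der-σ** p n = der-power-sum p (biunitaryExponent? (suc (suc (suc n)))) (inj₁ refl) (inj₂ λ ()) (suc (suc n))

-- Comparing values and derivatives at the root of linear p.
σ**≈power⇒ : ∀ {p q} n → n ≢ 0 → σ** p n ≈ linear q ^ n →
             p +₄ q ≡ 𝟏 × (n ≡ 2 ⊎ ∃ λ k → n ≡ suc (k ℕ.+ k))
σ**≈power⇒ {p} {q} n n≢0 eq = go n n≢0 values derivatives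
  where
  open ≡-Reasoning
  d : 𝔽₄
  d = p +₄ q
  values : 𝟏 ≡ eval p (linear q ^ n)
  values = trans (sym (eval-σ** p n)) (eval-cong p eq)
  derivatives : ∀ m → n ≡ suc (suc (suc m)) → 𝟏 ≡ der p (linear q ^ n)
  derivatives m refl = trans (sym (der-σ** p m)) (der-cong p eq)
  -- The multiplicative group has odd order, so it has no element of order 2.
  d²≡𝟏⇒d≡𝟏 : ∀ d → d *₄ (d *₄ 𝟏) ≡ 𝟏 → d ≡ 𝟏
  d²≡𝟏⇒d≡𝟏 = from-yes (∀? λ d → (d *₄ (d *₄ 𝟏) ≟ 𝟏) →-dec (d ≟ 𝟏))
  go : ∀ n → n ≢ 0 → 𝟏 ≡ eval p (linear q ^ n) →
       (∀ m → n ≡ suc (suc (suc m)) → 𝟏 ≡ der p (linear q ^ n)) →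
       d ≡ 𝟏 × (n ≡ 2 ⊎ ∃ λ k → n ≡ suc (k ℕ.+ k))
  go zero n≢0 _ _ = contradiction refl n≢0
  go (suc zero) _ val _ = sym (begin
    𝟏                         ≡⟨ val ⟩
    eval p (linear q ^ 1)     ≡⟨ eval-linear^-suc p q 0 ⟩
    d *₄ eval p 1#            ≡⟨ cong (d *₄_) (eval-1# p) ⟩
    d *₄ 𝟏                    ≡⟨ *₄-identityʳ d ⟩
    d                         ∎) , inj₂ (0 , refl)
  go (suc (suc zero)) _ val _ = d²≡𝟏⇒d≡𝟏 d (sym (begin
    𝟏                                ≡⟨ val ⟩
    eval p (linear q ^ 2)            ≡⟨ eval-linear^-suc p q 1 ⟩
    d *₄ eval p (linear q ^ 1)       ≡⟨ cong (d *₄_) (eval-linear^-suc p q 0) ⟩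
    d *₄ (d *₄ eval p 1#)            ≡⟨ cong (λ u → d *₄ (d *₄ u)) (eval-1# p) ⟩
    d *₄ (d *₄ 𝟏)                    ∎)) , inj₁ refl
  go n@(suc (suc (suc m))) _ val dif with parity n
  -- An even power has derivative 0, whereas that of σ** is 1.
  ... | k , inj₁ n≡k+k = contradiction
    (trans (dif m refl) (trans (cong (λ i → der p (linear q ^ i)) n≡k+k) (der-linear^-even p q k))) λ ()
  -- At an odd exponent the value of the power is d times its derivative. Both are 1, so d is 1 and
  -- no power of d has to be evaluated.
  ... | k , inj₂ n≡1+k+k = sym (begin
    𝟏                                       ≡⟨ val ⟩
    eval p (linear q ^ n)                   ≡⟨ cong (λ i → eval p (linear q ^ i)) n≡1+k+k ⟩
    eval p (linear q ^ suc (k ℕ.+ k))       ≡⟨ eval-linear^-suc p q (k ℕ.+ k) ⟩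
    d *₄ eval p (linear q ^ (k ℕ.+ k))      ≡⟨ cong (d *₄_) (der-linear^-odd p q k) ⟨
    d *₄ der p (linear q ^ suc (k ℕ.+ k))   ≡⟨ cong (λ i → d *₄ der p (linear q ^ i)) n≡1+k+k ⟨
    d *₄ der p (linear q ^ n)               ≡⟨ cong (d *₄_) (dif m refl) ⟨
    d *₄ 𝟏                                  ≡⟨ *₄-identityʳ d ⟩
    d                                       ∎) , inj₂ (k , n≡1+k+k)

-- Odd exponents: geometric sums and powers of two

geometric-sum : ∀ y n → (y + 1#) * ∑ (map (y ^_) (downFrom n)) ≈ y ^ n + 1#
geometric-sum y zero    = ≈-trans (*-zeroʳ (y + 1#)) (≈-sym (+-self 1#))
geometric-sum y (suc n) = begin
  (y + 1#) * (y ^ n + G)                     ≈⟨ distribˡ (y + 1#) (y ^ n) G ⟩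
  (y + 1#) * y ^ n + (y + 1#) * G            ≈⟨ +-congˡ {(y + 1#) * y ^ n} (geometric-sum y n) ⟩
  (y + 1#) * y ^ n + (y ^ n + 1#)            ≈⟨ solve 2 (λ y z → (y :+ con 𝟏) :* z :+ (z :+ con 𝟏) := y :* z :+ con 𝟏) ≈-refl y (y ^ n) ⟩
  y ^ suc n + 1#                             ∎
  where
  open ≈-Reasoning
  open Poly-Solver using (solve; _:=_; _:+_; _:*_; con)
  G : Poly
  G = ∑ (map (y ^_) (downFrom n))

-- Only half of n could be excluded, and an odd n has no half.
exponents-odd : ∀ k → exponents (suc (k ℕ.+ k)) ≡ downFrom (suc (suc (k ℕ.+ k)))
exponents-odd k = filter-all (biunitaryExponent? (suc (k ℕ.+ k)))
  (universal (λ i → inj₂ (i+i≢1+k+k i k)) (downFrom (suc (suc (k ℕ.+ k)))))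

module _ {p q : 𝔽₄} (p+q≡𝟏 : p +₄ q ≡ 𝟏) where

  opaque
    unfolding linear

    linear-shift : linear q ≈ linear p + 1#
    linear-shift = ∷-cong (shift p q p+q≡𝟏) ≈-refl
      where
      shift : ∀ p q → p +₄ q ≡ 𝟏 → q ≡ p +₄ 𝟏
      shift = from-yes (∀? λ p → ∀? λ q → (p +₄ q ≟ 𝟏) →-dec (q ≟ p +₄ 𝟏))

  eval-linear^-shift : ∀ n → eval p (linear q ^ n) ≡ 𝟏
  eval-linear^-shift zero    = eval-1# p
  eval-linear^-shift (suc n) = trans (eval-linear^-suc p q n) (cong₂ _*₄_ p+q≡𝟏 (eval-linear^-shift n))

  -- Halving is legitimate since squaring is injective, and an odd exponent other than 1 is excluded by
  -- the derivatives at the root of linear p.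
  frobenius⇒power-of-2 : ∀ n → n ≢ 0 → linear q ^ n ≈ linear p ^ n + 1# → ∃ λ k → n ≡ 2 ℕ.^ k
  frobenius⇒power-of-2 = <-rec _ step
    where
    step : ∀ n → (∀ {m} → m < n → m ≢ 0 → linear q ^ m ≈ linear p ^ m + 1# → ∃ λ k → m ≡ 2 ℕ.^ k) →
           n ≢ 0 → linear q ^ n ≈ linear p ^ n + 1# → ∃ λ k → n ≡ 2 ℕ.^ k
    step n rec n≢0 eq with parity n
    ... | zero  , inj₁ refl = contradiction refl n≢0
    ... | m@(suc m-1) , inj₁ refl =
      let k , m≡2^k = rec (ℕₚ.m<m+n m (s≤s z≤n)) (λ ()) (square-injective (linear q ^ m) (linear p ^ m + 1#) (begin
            linear q ^ m * linear q ^ m                 ≈⟨ ^-homo-* (linear q) m m ⟨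
            linear q ^ (m ℕ.+ m)                        ≈⟨ eq ⟩
            linear p ^ (m ℕ.+ m) + 1#                   ≈⟨ +-congʳ {1#} (^-homo-* (linear p) m m) ⟩
            linear p ^ m * linear p ^ m + 1#            ≈⟨ solve 1 (λ y → y :* y :+ con 𝟏 := (y :+ con 𝟏) :* (y :+ con 𝟏)) ≈-refl (linear p ^ m) ⟩
            (linear p ^ m + 1#) * (linear p ^ m + 1#)   ∎))
      in suc k , trans (cong₂ ℕ._+_ m≡2^k m≡2^k) (cong (2 ℕ.^ k ℕ.+_) (sym (ℕₚ.+-identityʳ (2 ℕ.^ k))))
      where
      open ≈-Reasoning
      open Poly-Solver using (solve; _:=_; _:+_; _:*_; con)
    ... | zero  , inj₂ refl = 0 , refl
    ... | suc m , inj₂ refl = contradiction (begin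
      𝟏                                                     ≡⟨ eval-linear^-shift (suc m ℕ.+ suc m) ⟨
      eval p (linear q ^ (suc m ℕ.+ suc m))                 ≡⟨ der-linear^-odd p q (suc m) ⟨
      der p (linear q ^ suc (suc m ℕ.+ suc m))              ≡⟨ der-cong p eq ⟩
      der p (linear p ^ suc (suc m ℕ.+ suc m) + 1#)         ≡⟨ der-+ p (linear p ^ suc (suc m ℕ.+ suc m)) 1# ⟩
      der p (linear p ^ suc (suc m ℕ.+ suc m)) +₄ der p 1#  ≡⟨ cong₂ _+₄_ (der-linear^-self p (m ℕ.+ suc m)) (der-1# p) ⟩
      𝟎                                                     ∎) λ ()
      where open ≡-Reasoning

  -- The equation is multiplied by `linear q`, which is also `linear p + 1#`: the power on one side
  -- gains a factor, and the full geometric sum on the other telescopes.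
  σ**≈power⇒frobenius : ∀ k → let n = suc (k ℕ.+ k) in
                        σ** p n ≈ linear q ^ n → linear q ^ suc n ≈ linear p ^ suc n + 1#
  σ**≈power⇒frobenius k eq = begin
    linear q * linear q ^ n                                        ≈⟨ *-cong linear-shift (≈-sym eq) ⟩
    (linear p + 1#) * σ** p n                                      ≡⟨ cong (λ l → (linear p + 1#) * ∑ (map (linear p ^_) l)) (exponents-odd k) ⟩
    (linear p + 1#) * ∑ (map (linear p ^_) (downFrom (suc n)))     ≈⟨ geometric-sum (linear p) (suc n) ⟩
    linear p ^ suc n + 1#                                          ∎
    where
    open ≈-Reasoning
    n : ℕ
    n = suc (k ℕ.+ k)

σ**≈power⇒𝒯 : ∀ {p q} n → n ≢ 0 → σ** p n ≈ linear q ^ n → p +₄ q ≡ 𝟏 × 𝒯 n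
σ**≈power⇒𝒯 {p} {q} n n≢0 eq with σ**≈power⇒ {p} {q} n n≢0 eq
... | p+q≡𝟏 , inj₁ refl = p+q≡𝟏 , s≤s z≤n , inj₁ refl
... | p+q≡𝟏 , inj₂ (k , refl) = p+q≡𝟏 , s≤s z≤n , inj₂ (exponent
  (frobenius⇒power-of-2 p+q≡𝟏 (suc n) (λ ()) (σ**≈power⇒frobenius p+q≡𝟏 k eq)))
  where
  exponent : (∃ λ j → suc n ≡ 2 ℕ.^ j) → ∃ λ j → j ≥ 1 × n ≡ 2 ℕ.^ j ∸ 1
  -- The power 2⁰ would give n = 0; its exclusion provides the bound j ≥ 1 required by `𝒯`.
  exponent (zero  , 1+n≡1)   = contradiction (ℕₚ.suc-injective 1+n≡1) n≢0
  exponent (suc j , 1+n≡2^j) = suc j , s≤s z≤n , cong (_∸ 1) 1+n≡2^j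

-- Bi-unitary perfect products of powers of two linear polynomials

eval≡𝟏⇒HasValuation-0 : ∀ {c s} → eval c s ≡ 𝟏 → HasValuation c s 0
eval≡𝟏⇒HasValuation-0 {c} {s} eval≡𝟏 = HasValuation-0 {c} {s} λ e → contradiction (trans (sym eval≡𝟏) e) λ ()

module _ {p q : 𝔽₄} (p≢q : p ≢ q) where

  -- The factor σ** p (e p) is coprime to linear p, so it absorbs exactly the power of linear q.
  σ**≈power : ∀ {e} → (∀ c → c ≢ p → c ≢ q → e c ≡ 0) → σ** p (e p) * σ** q (e q) ≈ ∏ e →
              e p ≡ e q × σ** p (e p) ≈ linear q ^ e p
  σ**≈power {e} e-zero eq = ep≡eq , (begin
    σ** p (e p)             ≈⟨ q≈ ⟩
    C u * ∏ f               ≈⟨ *-congʳ {∏ f} {C u} {1#} (∷-cong u≡𝟏 ≈-refl) ⟩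
    1# * ∏ f                ≈⟨ *-identityˡ (∏ f) ⟩
    ∏ f                     ≈⟨ ∏f≈ ⟩
    linear q ^ e q          ≈⟨ ^-congʳ (linear q) ep≡eq ⟨
    linear q ^ e p          ∎)
    where
    open ≈-Reasoning
    open Factorization (factorization (σ** p (e p)) (σ** q (e q)) e eq)
    fp≡0 : f p ≡ 0
    fp≡0 = HasValuation-unique (HasValuation-cong (≈-sym q≈) (HasValuation-C* u≢𝟎 (HasValuation-∏ p f)))
                               (eval≡𝟏⇒HasValuation-0 (eval-σ** p (e p)))
    gq≡0 : g q ≡ 0
    gq≡0 = HasValuation-unique (HasValuation-cong (≈-sym d≈) (HasValuation-C* v≢𝟎 (HasValuation-∏ q g)))
                               (eval≡𝟏⇒HasValuation-0 (eval-σ** q (e q)))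
    fq≡eq : f q ≡ e q
    fq≡eq = trans (sym (trans (cong (f q ℕ.+_) gq≡0) (ℕₚ.+-identityʳ (f q)))) (f+g≗e q)
    ∏f≈ : ∏ f ≈ linear q ^ e q
    ∏f≈ = begin
      ∏ f                             ≈⟨ ∏-supported-on-pair f p≢q (λ c c≢p c≢q →
                                           ℕₚ.m+n≡0⇒m≡0 (f c) (trans (f+g≗e c) (e-zero c c≢p c≢q))) ⟩
      linear p ^ f p * linear q ^ f q ≈⟨ *-cong (^-congʳ (linear p) fp≡0) (^-congʳ (linear q) fq≡eq) ⟩
      1# * linear q ^ e q             ≈⟨ *-identityˡ (linear q ^ e q) ⟩
      linear q ^ e q                  ∎
    -- σ** is monic of degree e p, because n is always a bi-unitary exponent of itself; comparing
    -- with a scalar multiple of a power of `linear q` equates the exponents and makes the scalar 1.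
    degrees : e p ≡ e q × 𝟏 ≡ u *₄ 𝟏
    degrees = HasDegree-unique (HasDegree-σ** p (e p))
      (HasDegree-cong (≈-sym (≈-trans q≈ (*-congˡ {C u} ∏f≈))) (HasDegree-C* u≢𝟎 (HasDegree-linear^ q (e q))))
    ep≡eq : e p ≡ e q
    ep≡eq = proj₁ degrees
    u≡𝟏 : u ≡ 𝟏
    u≡𝟏 = trans (sym (*₄-identityʳ u)) (sym (proj₂ degrees))

opaque
  unfolding linear

  -- Adding 1 pairs 0 with 1 and α with α + 1; these two pairs are the roots of the two base
  -- polynomials of Σ.
  linear-shift-product : ∀ p q → p +₄ q ≡ 𝟏 →
    linear p * linear q ≈ X ^ 2 + X ⊎ linear p * linear q ≈ X ^ 2 + X + 1#
  linear-shift-product 𝟎   𝟏   _ = inj₁ (mk≈ λ { 0 → refl ; 1 → refl ; 2 → refl ; 3 → refl ; (suc (suc (suc (suc i)))) → refl })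
  linear-shift-product 𝟏   𝟎   _ = inj₁ (mk≈ λ { 0 → refl ; 1 → refl ; 2 → refl ; 3 → refl ; (suc (suc (suc (suc i)))) → refl })
  linear-shift-product α   α+1 _ = inj₂ (mk≈ λ { 0 → refl ; 1 → refl ; 2 → refl ; 3 → refl ; (suc (suc (suc (suc i)))) → refl })
  linear-shift-product α+1 α   _ = inj₂ (mk≈ λ { 0 → refl ; 1 → refl ; 2 → refl ; 3 → refl ; (suc (suc (suc (suc i)))) → refl })

module _ {p q : 𝔽₄} (p≢q : p ≢ q) {s : Poly} {e : 𝔽₄ → ℕ} (s≈ : s ≈ ∏ e)
         (e-zero : ∀ c → c ≢ p → c ≢ q → e c ≡ 0) (perfect : BiunitaryPerfect s) where

  perfect⇒equal-exponents : e p ≡ e q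
  perfect⇒equal-exponents = proj₁ (σ**≈power p≢q e-zero (perfect⇒σ**-product p≢q s≈ e-zero perfect))

  perfect⇒∈Σ : e p ≢ 0 → s ∈Σ
  perfect⇒∈Σ ep≢0 = e p , proj₂ shape , [ (λ pq≈ → inj₁ (via (X ^ 2 + X) pq≈)) , (λ pq≈ → inj₂ (via (X ^ 2 + X + 1#) pq≈)) ]′
                                            (linear-shift-product p q (proj₁ shape))
    where
    open ≈-Reasoning
    shape : p +₄ q ≡ 𝟏 × 𝒯 (e p)
    shape = σ**≈power⇒𝒯 {p} {q} (e p) ep≢0
      (proj₂ (σ**≈power p≢q e-zero (perfect⇒σ**-product p≢q s≈ e-zero perfect)))
    via : ∀ t → linear p * linear q ≈ t → s ≈ t ^ e p
    via t pq≈t = begin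
      s                                 ≈⟨ s≈ ⟩
      ∏ e                               ≈⟨ ∏-supported-on-pair e p≢q e-zero ⟩
      linear p ^ e p * linear q ^ e q   ≈⟨ *-congˡ {linear p ^ e p} (^-congʳ (linear q) perfect⇒equal-exponents) ⟨
      linear p ^ e p * linear q ^ e p   ≈⟨ ^-distrib-* (linear p) (linear q) (e p) ⟨
      (linear p * linear q) ^ e p       ≈⟨ ^-congˡ (e p) pq≈t ⟩
      t ^ e p                           ∎

-- A lower bound for the number of roots

TwoRoots : (𝔽₄ → ℕ) → Set
TwoRoots e = ∃₂ λ p q → p ≢ q × e p ≢ 0 × e q ≢ 0

twoRoots? : ∀ e → Dec (TwoRoots e)
twoRoots? e = ∃? λ p → ∃? λ q → ¬? (p ≟ q) ×-dec ¬? (e p ℕₚ.≟ 0) ×-dec ¬? (e q ℕₚ.≟ 0)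

-- A sole root p is treated as the pair p, p + 1, where the second point serves only as some element
-- different from p. Equality of the two exponents then forces the exponent at p to be 0.
perfect⇒two-roots : ∀ {s e} → s ≈ ∏ e → BiunitaryPerfect s → (∀ c → e c ≡ 0) ⊎ TwoRoots e
perfect⇒two-roots {s} {e} s≈ perfect = [ inj₂ , (λ ¬two → inj₁ (λ c → zero-at ¬two c)) ]′ (toSum (twoRoots? e))
  where
  p≢p+𝟏 : ∀ p → p ≢ p +₄ 𝟏
  p≢p+𝟏 = from-yes (∀? λ p → ¬? (p ≟ p +₄ 𝟏))
  zero-at : ¬ TwoRoots e → ∀ c → e c ≡ 0
  zero-at ¬two p = decidable-stable (e p ℕₚ.≟ 0) λ ep≢0 →
    let e-zero : ∀ c → c ≢ p → c ≢ p +₄ 𝟏 → e c ≡ 0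
        e-zero c c≢p _ = decidable-stable (e c ℕₚ.≟ 0) λ ec≢0 → ¬two (p , c , c≢p ∘ sym , ep≢0 , ec≢0)
    in ¬two (p , p +₄ 𝟏 , p≢p+𝟏 p , ep≢0
            , λ eq≡0 → ep≢0 (trans (perfect⇒equal-exponents (p≢p+𝟏 p) s≈ e-zero perfect) eq≡0))

-- Irreducible factors

degree-zero⇒∣1# : ∀ {p u} → HasDegree p 0 u → p ∣ 1#
degree-zero⇒∣1# d = ∣-respˡ (≈-sym (HasDegree-zero d)) (C∣1# (nonzero d))

linear-irreducible : ∀ c → Irreducible (linear c)
linear-irreducible c = record { p∤1 = linear∤1# c ; split-∣1 = split }
  where
  split : ∀ {p q} → linear c ≈ p * q → p ∣ 1# ⊎ q ∣ 1#
  split {p} {q} eq with degree? p | degree? q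
  ... | inj₁ p≈[] | _ = contradiction (≈-trans eq (*-congʳ-zero p≈[] q)) (HasDegree⇒≉0# (HasDegree-linear c))
  ... | inj₂ _ | inj₁ q≈[] = contradiction (≈-trans eq (≈-trans (*-congˡ {p} q≈[]) (*-zeroʳ p))) (HasDegree⇒≉0# (HasDegree-linear c))
  ... | inj₂ (zero , _ , dp) | inj₂ _ = inj₁ (degree-zero⇒∣1# dp)
  ... | inj₂ _ | inj₂ (zero , _ , dq) = inj₂ (degree-zero⇒∣1# dq)
  ... | inj₂ (suc n , _ , dp) | inj₂ (suc m , _ , dq) = contradiction
    (trans (sym (ℕₚ.+-suc n m)) (ℕₚ.suc-injective (proj₁ (HasDegree-unique (HasDegree-cong (≈-sym eq) (HasDegree-* dp dq)) (HasDegree-linear c))))) λ ()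

linear-injective : ∀ {p q} → linear p ≈ linear q → p ≡ q
linear-injective {p} {q} eq = +₄≡𝟎⇒≡ p q (trans (sym (eval-linear p q)) (trans (sym (eval-cong p eq)) (eval-linear-self p)))

pigeonhole₂ : ∀ {x y p q r} → p ∈ x ∷ y ∷ [] → q ∈ x ∷ y ∷ [] → r ∈ x ∷ y ∷ [] → p ≈ q ⊎ p ≈ r ⊎ q ≈ r
pigeonhole₂ (here p≈x) (here q≈x) _ = inj₁ (≈-trans p≈x (≈-sym q≈x))
pigeonhole₂ (here p≈x) (there _) (here r≈x) = inj₂ (inj₁ (≈-trans p≈x (≈-sym r≈x)))
pigeonhole₂ (here _) (there (here q≈y)) (there (here r≈y)) = inj₂ (inj₂ (≈-trans q≈y (≈-sym r≈y)))
pigeonhole₂ (there (here p≈y)) (there (here q≈y)) _ = inj₁ (≈-trans p≈y (≈-sym q≈y))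
pigeonhole₂ (there (here p≈y)) (here _) (there (here r≈y)) = inj₂ (inj₁ (≈-trans p≈y (≈-sym r≈y)))
pigeonhole₂ (there (here _)) (here q≈x) (here r≈x) = inj₂ (inj₂ (≈-trans q≈x (≈-sym r≈x)))

∏≈1# : ∀ {e} → (∀ c → e c ≡ 0) → ∏ e ≈ 1#
∏≈1# e≗0 = ≈-trans (∏-cong e≗0) ∏-zero

-- The listing bounds the number of roots from above, as distinct roots give distinct irreducible
-- factors. Perfection supplies two roots once `∏ e` differs from 1, which holds because an
-- irreducible P divides it.
perfect∧ω≡2⇒two-roots : ∀ e → BiunitaryPerfect (∏ e) → ω[ ∏ e ]= 2 →
                        ∃₂ λ p q → p ≢ q × e p ≢ 0 × (∀ c → c ≢ p → c ≢ q → e c ≡ 0)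
perfect∧ω≡2⇒two-roots e perfect (P ∷ Q ∷ [] , (_ , ∈L⇔) , refl) =
  [ trivial , nontrivial ]′ (perfect⇒two-roots {e = e} ≈-refl perfect)
  where
  trivial : (∀ c → e c ≡ 0) → _
  trivial e≗0 = contradiction (∣-respʳ (∏≈1# e≗0) (proj₂ (proj₂ P-factor))) (Irreducible.p∤1 (proj₁ (proj₂ P-factor)))
    where
    P-factor : Monic P × Irreducible P × P ∣ ∏ e
    P-factor = to (∈L⇔ P) (here ≈-refl)
  root∈L : ∀ c → e c ≢ 0 → linear c ∈ P ∷ Q ∷ []
  root∈L c ec≢0 = from (∈L⇔ (linear c))
    (HasDegree⇒monic (HasDegree-linear c) , linear-irreducible c , linear∣∏ c e ec≢0)
  nontrivial : TwoRoots e → _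
  nontrivial (p , q , p≢q , ep≢0 , eq≢0) = p , q , p≢q , ep≢0 , λ c c≢p c≢q →
    decidable-stable (e c ℕₚ.≟ 0) λ ec≢0 →
      case pigeonhole₂ (root∈L p ep≢0) (root∈L q eq≢0) (root∈L c ec≢0) of λ
        { (inj₁ p≈q) → p≢q (linear-injective p≈q)
        ; (inj₂ (inj₁ p≈c)) → c≢p (sym (linear-injective p≈c))
        ; (inj₂ (inj₂ q≈c)) → c≢q (sym (linear-injective q≈c)) }

perfect∧ω≡2⇒∈Σ : ∀ e → BiunitaryPerfect (∏ e) → ω[ ∏ e ]= 2 → ∏ e ∈Σ
perfect∧ω≡2⇒∈Σ e perfect ω≡2 =
  let _ , _ , p≢q , ep≢0 , e-zero = perfect∧ω≡2⇒two-roots e perfect ω≡2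
  in perfect⇒∈Σ p≢q ≈-refl e-zero perfect ep≢0

-- Trivially bi-unitary perfect polynomials

∣-product : ∀ {n} (As : Vector Poly n) i → As i ∣ product As
∣-product {suc n} As zero    = product (As ∘ suc) , *-comm (product (As ∘ suc)) (As zero)
∣-product {suc n} As (suc i) with ∣-product (As ∘ suc) i
... | q , eq = As zero * q , ≈-trans (*-assoc (As zero) q (As (suc i))) (*-congˡ {As zero} eq)

nonconstant⇒≉1# : ∀ {p} → Nonconstant p → ¬ p ≈ 1#
nonconstant⇒≉1# (suc n , _ , coeff≢𝟎) p≈1# = coeff≢𝟎 (coeff≗ p≈1# (suc n))

-- A monic divisor of `∏ e` again splits, so the bound on roots applies to it; being nonconstant
-- excludes the case without roots.
perfect-factor : ∀ {p} e → p ∣ ∏ e → Nonconstant p → BiunitaryPerfect p → ∃ λ f → p ≈ ∏ f × TwoRoots f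
perfect-factor {p} e (q , qp≈) nonconst perfect = g , d≈ ,
  [ (λ g≗0 → contradiction (≈-trans d≈ (∏≈1# g≗0)) (nonconstant⇒≉1# nonconst)) , id ]′ (perfect⇒two-roots d≈ perfect)
  where open MonicFactorization (monic-factorization q p e (proj₁ perfect) qp≈)

four-elements : ∀ p q p′ q′ c → p ≢ q → p′ ≢ q′ → p ≢ p′ → p ≢ q′ → q ≢ p′ → q ≢ q′ →
                c ≢ p → c ≢ q → c ≡ p′ ⊎ c ≡ q′
four-elements = from-yes (∀? λ p → ∀? λ q → ∀? λ p′ → ∀? λ q′ → ∀? λ c →
  ¬? (p ≟ q) →-dec ¬? (p′ ≟ q′) →-dec ¬? (p ≟ p′) →-dec ¬? (p ≟ q′) →-dec ¬? (q ≟ p′) →-dec ¬? (q ≟ q′) →-dec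
  ¬? (c ≟ p) →-dec ¬? (c ≟ q) →-dec ((c ≟ p′) ⊎-dec (c ≟ q′)))

Disjoint : (𝔽₄ → ℕ) → (𝔽₄ → ℕ) → Set
Disjoint f g = ∀ c → f c ≡ 0 ⊎ g c ≡ 0

disjoint⇒≢ : ∀ {f g c d} → Disjoint f g → f c ≢ 0 → g d ≢ 0 → c ≢ d
disjoint⇒≢ {c = c} disjoint fc≢0 gc≢0 refl = [ fc≢0 , gc≢0 ]′ (disjoint c)

disjoint-zero : ∀ {f g} c → Disjoint f g → f c ≢ 0 → g c ≡ 0
disjoint-zero c disjoint fc≢0 with disjoint c
... | inj₁ fc≡0 = contradiction fc≡0 fc≢0
... | inj₂ gc≡0 = gc≡0

-- 𝔽₄ has only four elements.
zero-outside-two-roots : ∀ {f g} → Disjoint f g → ((p , q , _) : TwoRoots f) → TwoRoots g →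
                         ∀ c → c ≢ p → c ≢ q → f c ≡ 0
zero-outside-two-roots {f} {g} disjoint (p , q , p≢q , fp≢0 , fq≢0) (p′ , q′ , p′≢q′ , gp′≢0 , gq′≢0) c c≢p c≢q =
  [ (λ { refl → zero-at gp′≢0 }) , (λ { refl → zero-at gq′≢0 }) ]′
    (four-elements p q p′ q′ c p≢q p′≢q′ (apart fp≢0 gp′≢0) (apart fp≢0 gq′≢0) (apart fq≢0 gp′≢0) (apart fq≢0 gq′≢0) c≢p c≢q)
  where
  apart : ∀ {c d} → f c ≢ 0 → g d ≢ 0 → c ≢ d
  apart = disjoint⇒≢ {f} {g} disjoint
  zero-at : ∀ {c} → g c ≢ 0 → f c ≡ 0
  zero-at {c} gc≢0 = disjoint-zero {g} {f} c (swap ∘ disjoint) gc≢0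

-- Two roots of f and two of g exhaust the field, so a single root of h already collides with one of
-- them.
no-three-disjoint : ∀ {f g h} → TwoRoots f → TwoRoots g → TwoRoots h →
                    Disjoint f g → Disjoint f h → ¬ Disjoint g h
no-three-disjoint {f} {g} {h} (p , q , p≢q , fp≢0 , fq≢0) (p′ , q′ , p′≢q′ , gp′≢0 , gq′≢0) (c , _ , _ , hc≢0 , _)
                  f#g f#h g#h =
  [ g-apart gp′≢0 ∘ sym , g-apart gq′≢0 ∘ sym ]′
    (four-elements p q p′ q′ c p≢q p′≢q′ (f-apart fp≢0 gp′≢0) (f-apart fp≢0 gq′≢0) (f-apart fq≢0 gp′≢0) (f-apart fq≢0 gq′≢0)
      (disjoint⇒≢ {f} {h} f#h fp≢0 hc≢0 ∘ sym) (disjoint⇒≢ {f} {h} f#h fq≢0 hc≢0 ∘ sym))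
  where
  f-apart : ∀ {c d} → f c ≢ 0 → g d ≢ 0 → c ≢ d
  f-apart = disjoint⇒≢ {f} {g} f#g
  g-apart : ∀ {d} → g d ≢ 0 → d ≢ c
  g-apart gd≢0 = disjoint⇒≢ {g} {h} g#h gd≢0 hc≢0

perfect∧disjoint⇒∈Σ : ∀ {s f g} → s ≈ ∏ f → BiunitaryPerfect s → TwoRoots f → TwoRoots g → Disjoint f g → s ∈Σ
perfect∧disjoint⇒∈Σ {f = f} {g} s≈ perfect two@(p , q , p≢q , fp≢0 , _) two′ f#g =
  perfect⇒∈Σ p≢q s≈ (zero-outside-two-roots {f} {g} f#g two two′) perfect fp≢0

trivially-perfect⇒∈Σ*∈Σ : ∀ e → TriviallyBiunitaryPerfect (∏ e) →
                          ∃₂ λ A₁ A₂ → A₁ ∈Σ × A₂ ∈Σ × ∏ e ≈ A₁ * A₂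
trivially-perfect⇒∈Σ*∈Σ e (_ , r , r≥1 , As , ∏e≈ , factors , coprime) =
  go r As r≥1 ∏e≈ (proj₂ ∘ factors) (proj₁ ∘ factor) (proj₁ ∘ proj₂ ∘ factor) (proj₂ ∘ proj₂ ∘ factor) disjoint
  where
  factor : ∀ i → ∃ λ f → As i ≈ ∏ f × TwoRoots f
  factor i = perfect-factor e (∣-respʳ (≈-sym ∏e≈) (∣-product As i)) (proj₁ (factors i)) (proj₂ (factors i))
  disjoint : ∀ i j → i ≢ j → Disjoint (proj₁ (factor i)) (proj₁ (factor j))
  disjoint i j i≢j = ∏-coprime⁻ (λ {z} →
    Coprime-resp (proj₁ (proj₂ (factor i))) (proj₁ (proj₂ (factor j))) (λ {y} → coprime i j i≢j {y}) {z})
  go : ∀ r (As : Vector Poly (suc r)) → r ≥ 1 → ∏ e ≈ product As → (∀ i → BiunitaryPerfect (As i)) →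
       (f : Fin (suc r) → 𝔽₄ → ℕ) → (∀ i → As i ≈ ∏ (f i)) → (∀ i → TwoRoots (f i)) →
       (∀ i j → i ≢ j → Disjoint (f i) (f j)) →
       ∃₂ λ A₁ A₂ → A₁ ∈Σ × A₂ ∈Σ × ∏ e ≈ A₁ * A₂
  -- Index r = 1 means two factors; r = 0 is excluded by r ≥ 1. Each factor confines the roots of
  -- the other to two points.
  go 1 As _ ∏e≈ perfect f As≈ two disjoint =
      As zero , As (suc zero)
    , perfect∧disjoint⇒∈Σ (As≈ zero) (perfect zero) (two zero) (two (suc zero)) (disjoint zero (suc zero) λ ())
    , perfect∧disjoint⇒∈Σ (As≈ (suc zero)) (perfect (suc zero)) (two (suc zero)) (two zero) (disjoint (suc zero) zero λ ())
    , ≈-trans ∏e≈ (*-congˡ {As zero} (*-identityʳ (As (suc zero))))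
  go (suc (suc r)) As _ _ _ f _ two disjoint = ⊥-elim (no-three-disjoint
    (two zero) (two (suc zero)) (two (suc (suc zero)))
    (disjoint zero (suc zero) λ ()) (disjoint zero (suc (suc zero)) λ ()) (disjoint (suc zero) (suc (suc zero)) λ ()))

-- From exponent vectors to the explicit polynomial

exponents-at : ℕ → ℕ → ℕ → ℕ → 𝔽₄ → ℕ
exponents-at a b c d 𝟎   = a
exponents-at a b c d 𝟏   = b
exponents-at a b c d α   = c
exponents-at a b c d α+1 = d

opaque
  unfolding ∏ linear

  -- Holds by computation once `∏` and `linear` are unfolded, as `X + C 𝟎` reduces to `X`. The
  -- result is transported along this equation, so that both stay opaque elsewhere.
  ∏-exponents-at : ∀ a b c d →
    ∏ (exponents-at a b c d) ≡ X ^ a * (X + 1#) ^ b * (X + C α) ^ c * (X + C α+1) ^ d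
  ∏-exponents-at a b c d = refl

proposition3p1 : (a b c d : ℕ) →
    let A = X ^ a * (X + 1#) ^ b * (X + C α) ^ c * (X + C α+1) ^ d in
    BiunitaryPerfect A →
    (ω[ A ]= 2 → A ∈Σ) ×
    (TriviallyBiunitaryPerfect A → ∀ w → ω[ A ]= w → w ≥ 3 →
    ∃₂ λ A₁ A₂ → A₁ ∈Σ × A₂ ∈Σ × A ≈ A₁ * A₂)
proposition3p1 a b c d = subst
  (λ A → BiunitaryPerfect A →
    (ω[ A ]= 2 → A ∈Σ) ×
    (TriviallyBiunitaryPerfect A → ∀ w → ω[ A ]= w → w ≥ 3 →
    ∃₂ λ A₁ A₂ → A₁ ∈Σ × A₂ ∈Σ × A ≈ A₁ * A₂))
  (∏-exponents-at a b c d)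
  (λ perfect → perfect∧ω≡2⇒∈Σ e perfect , λ trivially _ _ _ → trivially-perfect⇒∈Σ*∈Σ e trivially)
  where
  e : 𝔽₄ → ℕ
  e = exponents-at a b c d
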